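{- For $n,m\ge 0$ let $s_{n,m}$ be the number of permutations $\pi\in S_n$ with exactly $m$ vertical separators, and let $h(z,u)=\sum_{n\ge 0}\sum_{m=0}^{n}s_{n,m}z^nu^m$. Then $$h(z,u)=\sum_{m_o,m_e\ge 0}(m_o+m_e)!\left[\left(z^2+\frac{2z^4(u-1)}{1-z^2(u-1)}\right)^{m_o}\right]*\left[\left(z^2+\frac{2z^4(u-1)}{1-z^2(u-1)}\right)^{m_e}\right]$$ $$\qquad+\sum_{m_o,m_e\ge 0}(m_o+m_e)!\left[\frac1z\left(z^2+\frac{2z^4(u-1)}{1-z^2(u-1)}\right)^{m_o}\right]*\left[z\left(z^2+\frac{2z^4(u-1)}{1-z^2(u-1)}\right)^{m_e}\right],$$ where $*$ denotes the Hadamard product with respect to the variable $z$.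
   Context: $S_n$ is the symmetric group on $\{1,\dots,n\}$; a permutation is written in one-line notation $\pi=[\pi_1,\dots,\pi_n]$. The digit $\pi_i$ is a vertical separator of $\pi$ if $1<i<n$ and $|\pi_{i-1}-\pi_{i+1}|=1$. Convention: $S_0$ consists of the empty permutation, which has no separators, so $s_{0,0}=1$. Hadamard product: for series $f=\sum_n a_nz^n$ and $g=\sum_n b_nz^n$ in $z$ with coefficients $a_n,b_n\in\mathbb{Q}[[u]]$, $f*g=\sum_n a_nb_nz^n$. The fraction $\frac{1}{1-z^2(u-1)}$ is expanded as the geometric series $\sum_{j\ge0}z^{2j}(u-1)^j$ in $z$. Products are coefficientwise also for Laurent series in $z$: when $m_o=0$, the left factor in the second sum is $z^{ -1}$, and its Hadamard product with a power series in $z$ is $0$. The sums over $m_o,m_e$ are sums of formal power series in $z$ (only finitely many terms contribute to each power of $z$). -}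

module Defs where

open import Algebra.Bundles.Raw using (RawRing)
import Algebra.Definitions.RawSemiring as RawSemiringDefs
open import Data.Fin.Base using (Fin; toℕ)
open import Data.Fin.Properties using (_≟_; all?; any?)
open import Data.Integer.Base as ℤ using (ℤ; +_; -[1+_])
open import Data.List.Base using (List; []; _∷_; allFin; cartesianProductWith; filter; length)
open import Data.Nat.Base using (ℕ; zero; suc; _∸_; _≤_; ∣_-_∣; _!) renaming (_+_ to _+ₙ_)
import Data.Nat.Properties as ℕₚ
open import Data.Product.Base using (_×_; _,_; ∃; ∃₂; proj₁; proj₂)
import Data.Rational.Base as ℚ
open import Data.Sum.Base using (_⊎_)
open import Data.Vec.Base using (Vec; []; _∷_; lookup)
open import Function.Base using (_∘_)
open import Function.Consequences.Propositional using (strictlySurjective⇒surjective)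
open import Function.Definitions using (Bijective; Injective)
open import Level using (Level; 0ℓ)
open import Relation.Binary.PropositionalEquality using (_≡_; refl)
open import Relation.Nullary.Decidable using (Dec; map′; _×-dec_; _→-dec_)

------------------------------------------------------------------------
-- Permutations and vertical separators

-- One-line notation.  Positions and digits are 0-based: the 1-based
-- position i (digit d) is the element of Fin n with toℕ equal to i - 1
-- (d - 1).  The shift does not affect differences of digits.
IsPermutation : ∀ {n} → Vec (Fin n) n → Set
IsPermutation π = Bijective _≡_ _≡_ (lookup π)

isPermutation? : ∀ {n} (π : Vec (Fin n) n) → Dec (IsPermutation π)
isPermutation? π =
  map′ (λ inj {x} {y} → inj x y) (λ inj x y → inj {x} {y})
       (all? λ x → all? λ y → (lookup π x ≟ lookup π y) →-dec (x ≟ y))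
  ×-dec
  map′ strictlySurjective⇒surjective (λ sur y → proj₁ (sur y) , proj₂ (sur y) refl)
       (all? λ y → any? λ x → lookup π x ≟ y)

words : ∀ n k → List (Vec (Fin n) k)
words n zero    = [] ∷ []
words n (suc k) = cartesianProductWith _∷_ (allFin n) (words n k)

S : ∀ n → List (Vec (Fin n) n)
S n = filter isPermutation? (words n n)

-- The existence of the neighbouring positions j = i - 1 and k = i + 1
-- is the condition 1 < i < n.
IsVerticalSeparator : ∀ {n} → Vec (Fin n) n → Fin n → Set
IsVerticalSeparator π i = ∃₂ λ j k →
  suc (toℕ j) ≡ toℕ i × suc (toℕ i) ≡ toℕ k ×
  ∣ toℕ (lookup π j) - toℕ (lookup π k) ∣ ≡ 1

isVerticalSeparator? : ∀ {n} (π : Vec (Fin n) n) i → Dec (IsVerticalSeparator π i)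
isVerticalSeparator? π i = any? λ j → any? λ k →
  (suc (toℕ j) ℕₚ.≟ toℕ i) ×-dec (suc (toℕ i) ℕₚ.≟ toℕ k) ×-dec
  (∣ toℕ (lookup π j) - toℕ (lookup π k) ∣ ℕₚ.≟ 1)

separators : ∀ {n} → Vec (Fin n) n → ℕ
separators π = length (filter (isVerticalSeparator? π) (allFin _))

s : ℕ → ℕ → ℕ
s n m = length (filter (λ π → separators π ℕₚ.≟ m) (S n))

------------------------------------------------------------------------
-- Formal power series and Laurent series in one variable

module _ {c ℓ} (R : RawRing c ℓ) where
  open RawRing R
  open RawSemiringDefs rawSemiring using (sum) renaming (_×_ to _·_)

  Series : Set c
  Series = ℕ → Carrier

  const : Carrier → Series
  const a zero    = a
  const a (suc _) = 0#

  powerSeries : RawRing c ℓ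
  powerSeries = record
    { Carrier = Series
    ; _≈_     = λ f g → ∀ n → f n ≈ g n
    ; _+_     = λ f g n → f n + g n
    ; _*_     = λ f g n → sum {suc n} λ k → f (toℕ k) * g (n ∸ toℕ k)
    ; -_      = λ f n → - f n
    ; 0#      = λ _ → 0#
    ; 1#      = const 1#
    }

  var : Series
  var 1 = 1#
  var _ = 0#

  -- The expansion Σ_{j ≥ 0} a^j z^{2j} of 1 / (1 - a z²).
  geometric : Carrier → Series
  geometric a zero          = 1#
  geometric a (suc zero)    = 0#
  geometric a (suc (suc n)) = a * geometric a n

  -- (k , f) stands for z^k f.  Representations are not unique; Laurent
  -- series are only ever compared through their coefficients.
  Laurent : Set c
  Laurent = ℤ × Series

  coeff : Laurent → ℤ → Carrier
  coeff (k , f) i with i ℤ.- k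
  ... | + n      = f n
  ... | -[1+ _ ] = 0#

  fromSeries : Series → Laurent
  fromSeries f = + 0 , f

  var⁻¹ : Laurent
  var⁻¹ = -[1+ 0 ] , const 1#

  _*ᴸ_ : Laurent → Laurent → Laurent
  (k , f) *ᴸ (l , g) = k ℤ.+ l , RawRing._*_ powerSeries f g

  hadamard : Laurent → Laurent → ℤ → Carrier
  hadamard f g i = coeff f i * coeff g i

  -- Σ_{p,q ≥ 0} F p q = f, where F p q is given by its coefficients: for
  -- each exponent i only finitely many F p q contribute, and their
  -- coefficients add up to that of f.
  HasDoubleSum : (ℕ → ℕ → ℤ → Carrier) → Series → Set ℓ
  HasDoubleSum F f = ∀ i → ∃ λ N →
    (∀ p q → N ≤ p ⊎ N ≤ q → F p q i ≈ 0#) ×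
    sum {N} (λ p → sum {N} (λ q → F (toℕ p) (toℕ q) i)) ≈ coeff (fromSeries f) i

------------------------------------------------------------------------
-- The generating function

ℚ⟦u⟧ : RawRing 0ℓ 0ℓ
ℚ⟦u⟧ = powerSeries ℚ.+-*-rawRing

ℚ⟦u⟧⟦z⟧ : RawRing 0ℓ 0ℓ
ℚ⟦u⟧⟦z⟧ = powerSeries ℚ⟦u⟧

u-1 : RawRing.Carrier ℚ⟦u⟧
u-1 = var ℚ.+-*-rawRing + - 1#
  where open RawRing ℚ⟦u⟧

h : RawRing.Carrier ℚ⟦u⟧⟦z⟧
h n = sum {suc n} λ m → s n (toℕ m) · (u ^ toℕ m)
  where
  open RawRing ℚ⟦u⟧
  open RawSemiringDefs rawSemiring using (sum; _^_) renaming (_×_ to _·_)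
  u = var ℚ.+-*-rawRing

z : RawRing.Carrier ℚ⟦u⟧⟦z⟧
z = var ℚ⟦u⟧

-- z² + 2 z⁴ (u - 1) / (1 - z² (u - 1))
block : RawRing.Carrier ℚ⟦u⟧⟦z⟧
block = z ^ 2 + 2 · (z ^ 4 * const ℚ⟦u⟧ u-1) * geometric ℚ⟦u⟧ u-1
  where
  open RawRing ℚ⟦u⟧⟦z⟧
  open RawSemiringDefs rawSemiring using (_^_) renaming (_×_ to _·_)

open RawSemiringDefs (RawRing.rawSemiring ℚ⟦u⟧) using () renaming (_×_ to _·_)
open RawRing ℚ⟦u⟧⟦z⟧ using () renaming (_≈_ to _≋_; _+_ to _⊕_; _*_ to _⊛_) public
open RawSemiringDefs (RawRing.rawSemiring ℚ⟦u⟧⟦z⟧) using () renaming (_^_ to _^ᶻ_)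

evenTerm : ℕ → ℕ → ℤ → RawRing.Carrier ℚ⟦u⟧
evenTerm mₒ mₑ i = ((mₒ +ₙ mₑ) !) ·
  hadamard ℚ⟦u⟧ (fromSeries ℚ⟦u⟧ (block ^ᶻ mₒ))
                (fromSeries ℚ⟦u⟧ (block ^ᶻ mₑ)) i

oddTerm : ℕ → ℕ → ℤ → RawRing.Carrier ℚ⟦u⟧
oddTerm mₒ mₑ i = ((mₒ +ₙ mₑ) !) ·
  hadamard ℚ⟦u⟧ (_*ᴸ_ ℚ⟦u⟧ (var⁻¹ ℚ⟦u⟧) (fromSeries ℚ⟦u⟧ (block ^ᶻ mₒ)))
                (fromSeries ℚ⟦u⟧ (z ⊛ (block ^ᶻ mₑ))) i

{-# OPTIONS --safe #-}

-- Write u = 1 + t and expand every factor 1 + t of u^(separators π):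
-- the generating function becomes a sum over sets M of marked places i
-- of t^|M| times the number of permutations for which π(i) and π(i+2)
-- are consecutive at every marked i.  Removing the first digit of π and
-- standardising the rest computes this number: a new first digit d
-- respects the marks on the rest unless it falls into the gap between
-- the two digits of a marked pair, and if the first place itself is
-- marked, then d has to be put next to the third digit, on either side
-- if that digit is not yet tied to another one.  The number is therefore
-- b! 2^r, where the marks join the positions to b blocks, r of them of
-- size at least 2.  The odd and the even positions form two paths, and
-- the marks on them are independent except for b = mₒ + mₑ.  Along each
-- path the weighted sum over the marks obeys the linear recurrence of
-- the coefficients of the powers of the series B = block, which comes from
-- B = z² + t z⁴ + t z² B.
module Submission where

open import Defs
open import Algebra.Bundles using (CommutativeRing)
open import Algebra.Bundles.Raw using (RawRing)
import Algebra.Definitions.RawSemiring as RawSemiringDefs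
import Algebra.Properties.Semiring.Sum as Sum
import Algebra.Solver.Ring.NaturalCoefficients.Default as Solver
open import Data.Bool.Base using (Bool; true; false)
open import Data.Empty using (⊥-elim)
open import Data.Fin.Base using (Fin; zero; suc; toℕ; inject₁; punchIn; punchOut)
open import Data.Fin.Properties using (_≟_; all?; any?; suc-injective; punchIn-injective; punchOut-injective; injective⇒≤)
open import Data.Integer.Base as ℤ using (ℤ; -[1+_])
open import Data.List.Base as List using (List; []; _∷_; _++_; allFin; tabulate; cartesianProductWith; filter; foldr; length)
open import Data.List.Properties using (filter-++; filter-≐; filter-all; filter-none; filter-accept; filter-reject; length-filter; length-tabulate; map-tabulate; map-∘; map-cong; map-++)
open import Data.List.Relation.Unary.All as All using (All; []; _∷_)
open import Data.List.Relation.Unary.All.Properties using (all-filter; map⁺; tabulate⁺)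
open import Data.Nat.Base using (ℕ; zero; suc; _∸_; _≤_; _<_; z≤n; s≤s; ∣_-_∣; ⌊_/2⌋; ⌈_/2⌉; _!) renaming (_+_ to _+ₙ_; _*_ to _*ₙ_)
import Data.Nat.Properties as ℕₚ
open import Data.Nat.Solver using (module +-*-Solver)
open import Data.Product.Base using (_×_; _,_; ∃₂; proj₁; proj₂)
import Data.Rational.Base as ℚ
import Data.Rational.Properties as ℚₚ
open import Data.Sum.Base using (_⊎_; inj₁; inj₂)
open import Data.Vec.Base as Vec using (Vec; []; _∷_; lookup)
open import Data.Vec.Properties using (lookup-map)
open import Function.Base using (_∘_; id)
open import Function.Consequences.Propositional using (strictlySurjective⇒surjective)
open import Function.Definitions using (Injective; StrictlySurjective)
open import Level using (0ℓ; _⊔_)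
import Relation.Binary.PropositionalEquality as ≡
open ≡ using (_≡_; _≢_)
open import Relation.Nullary.Decidable using (Dec; yes; no; map′; _→-dec_; ¬?)
open import Relation.Nullary.Negation using (¬_; contradiction)
open import Relation.Unary using (Pred; Decidable; _≐_)

-- Marks on positions and the weight of a set of marks.

-- A mark at i stands for the requirement that the digits at positions i
-- and i + 2 be consecutive; a mark without a position i + 2 cannot be
-- satisfied.  A new first position is joined to a path of k vertices in
-- joins k b ways, b telling whether the first vertex of the path is marked.
joins : ℕ → Bool → ℕ
joins zero    _     = 0
joins (suc _) false = 2
joins (suc _) true  = 1

-- Past the end the value is `false`: a missing position carries no mark, in agreement with
-- `L zero true ψ` being `0#` below.
first second : ∀ {n} → Vec Bool n → Bool
first []      = false
first (b ∷ _) = b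
second []      = false
second (_ ∷ M) = first M

#false #true : ∀ {n} → Vec Bool n → ℕ
#false []          = 0
#false (false ∷ M) = suc (#false M)
#false (true  ∷ M) = #false M
#true []          = 0
#true (false ∷ M) = #true M
#true (true  ∷ M) = suc (#true M)

-- This is 2^r if every mark has a partner two places on, and 0 otherwise. The next position on the
-- path of the head is the second entry of the tail, and `⌊ n /2⌋` vertices of that path remain. A
-- block of size at least 2 gets its factor 2 only once, at its last mark.
orientations : ∀ {n} → Vec Bool n → ℕ
orientations []              = 1
orientations (false ∷ M)     = orientations M
orientations {suc n} (true  ∷ M) = joins ⌊ n /2⌋ (second M) *ₙ orientations M

module Words where
  open import Relation.Binary.PropositionalEquality
  open import Data.Nat.Base using (_+_; _*_)
  open import Algebra.Properties.Semiring.Sum ℕₚ.+-*-semiring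
    using (sum; sum-cong-≗; sum-replicate-zero; *-distribˡ-sum)
  open +-*-Solver
  open ≡-Reasoning

  -- Consecutive digits and the insertion of a new digit.

  infix 8 _~_
  -- Being consecutive is encoded as a number 0 or 1, so that requirements multiply and counts
  -- become sums.
  _~_ : ℕ → ℕ → ℕ
  zero        ~ zero        = 0
  zero        ~ suc zero    = 1
  zero        ~ suc (suc _) = 0
  suc a       ~ suc b       = a ~ b
  suc zero    ~ zero        = 1
  suc (suc _) ~ zero        = 0

  adj : ∀ {n} → Fin n → Fin n → ℕ
  adj x y = toℕ x ~ toℕ y

  -- The value d for which punchIn d pulls apart the consecutive digits x
  -- and y; meaningless for other digits.
  gap : ∀ {n} → Fin n → Fin n → Fin (suc n)
  gap zero    y       = inject₁ y
  gap (suc x) zero    = inject₁ (suc x)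
  gap (suc x) (suc y) = suc (gap x y)

  private
    sum-1* : ∀ {n} a b (F : Fin n → ℕ) → 1 * a + sum (λ d → 1 * F d) + 1 * b ≡ 1 * (a + (b + sum F))
    sum-1* a b F = begin
      1 * a + sum (λ d → 1 * F d) + 1 * b ≡⟨ cong (λ x → 1 * a + x + 1 * b) (*-distribˡ-sum 1 F) ⟨
      1 * a + 1 * sum F + 1 * b
        ≡⟨ solve 3 (λ a b x → con 1 :* a :+ con 1 :* x :+ con 1 :* b := con 1 :* (a :+ (b :+ x))) refl a b (sum F) ⟩
      1 * (a + (b + sum F)) ∎

  -- Insertion never makes two digits consecutive, and it separates consecutive ones only at their
  -- gap. The gap term stands on the left to avoid subtraction; the weight `F` leaves room for the
  -- remaining marks.
  adj-punchIn-sum : ∀ {n} (x y : Fin n) (F : Fin (suc n) → ℕ) →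
    sum (λ d → adj (punchIn d x) (punchIn d y) * F d) + adj x y * F (gap x y) ≡ adj x y * sum F
  adj-punchIn-sum {suc n} zero zero F = trans (ℕₚ.+-identityʳ _) (sum-replicate-zero n)
  adj-punchIn-sum {suc (suc n)} zero (suc zero) F = sum-1* (F zero) (F (suc zero)) (λ d → F (suc (suc d)))
  adj-punchIn-sum {suc (suc n)} zero (suc (suc y)) F = trans (ℕₚ.+-identityʳ _) (sum-replicate-zero n)
  adj-punchIn-sum {suc (suc n)} (suc zero) zero F = sum-1* (F zero) (F (suc zero)) (λ d → F (suc (suc d)))
  adj-punchIn-sum {suc (suc n)} (suc (suc x)) zero F = trans (ℕₚ.+-identityʳ _) (sum-replicate-zero n)
  adj-punchIn-sum (suc x) (suc y) F = begin
    a * F zero + r + a * F (suc (gap x y))   ≡⟨ ℕₚ.+-assoc (a * F zero) _ _ ⟩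
    a * F zero + (r + a * F (suc (gap x y))) ≡⟨ cong (a * F zero +_) (adj-punchIn-sum x y (F ∘ suc)) ⟩
    a * F zero + a * sum (F ∘ suc)           ≡⟨ ℕₚ.*-distribˡ-+ a _ _ ⟨
    a * sum F                                ∎
    where
    a = adj x y
    r = sum (λ d → adj (punchIn d x) (punchIn d y) * F (suc d))

  -- The new digit is consecutive to the shifted `z` only when it is inserted directly below or
  -- directly above `z`.
  adj-punchIn-self-sum : ∀ {n} (z : Fin n) (F : Fin (suc n) → ℕ) →
    sum (λ d → adj d (punchIn d z) * F d) ≡ F (inject₁ z) + F (suc z)
  adj-punchIn-self-sum {suc n} zero    F =
    cong₂ _+_ (ℕₚ.*-identityˡ _) (trans (cong₂ _+_ (ℕₚ.*-identityˡ (F (suc zero)))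
      (sum-replicate-zero n)) (ℕₚ.+-identityʳ _))
  adj-punchIn-self-sum (suc z) F = adj-punchIn-self-sum z (F ∘ suc)

  _NextTo_ : ∀ {n} → Fin (suc n) → Fin n → Set
  g NextTo x = g ≡ inject₁ x ⊎ g ≡ suc x

  adj-punchIn-inject₁ : ∀ {n} {x a b : Fin n} → a ≢ x → b ≢ x →
    adj (punchIn (inject₁ x) a) (punchIn (inject₁ x) b) ≡ adj a b
  adj-punchIn-inject₁ {x = zero}  {a}     {b}     p q = refl
  adj-punchIn-inject₁ {x = suc x} {zero}  {zero}  p q = refl
  adj-punchIn-inject₁ {x = suc zero} {zero}  {suc zero} p q = ⊥-elim (q refl)
  adj-punchIn-inject₁ {x = suc (suc x)} {zero}  {suc zero} p q = refl
  adj-punchIn-inject₁ {x = suc zero} {zero}  {suc (suc b)} p q = refl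
  adj-punchIn-inject₁ {x = suc (suc x)} {zero}  {suc (suc b)} p q = refl
  adj-punchIn-inject₁ {x = suc zero} {suc zero}  {zero} p q = ⊥-elim (p refl)
  adj-punchIn-inject₁ {x = suc (suc x)} {suc zero}  {zero} p q = refl
  adj-punchIn-inject₁ {x = suc zero} {suc (suc a)}  {zero} p q = refl
  adj-punchIn-inject₁ {x = suc (suc x)} {suc (suc a)}  {zero} p q = refl
  adj-punchIn-inject₁ {x = suc x} {suc a} {suc b} p q =
    adj-punchIn-inject₁ {x = x} {a} {b} (p ∘ cong suc) (q ∘ cong suc)

  adj-punchIn-suc : ∀ {n} {x a b : Fin n} → a ≢ x → b ≢ x →
    adj (punchIn (suc x) a) (punchIn (suc x) b) ≡ adj a b
  adj-punchIn-suc {x = x}     {zero}  {zero}  p q = refl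
  adj-punchIn-suc {x = zero}  {zero}          p q = ⊥-elim (p refl)
  adj-punchIn-suc {x = zero}  {suc a} {zero}  p q = ⊥-elim (q refl)
  adj-punchIn-suc {x = zero}  {suc a} {suc b} p q = refl
  adj-punchIn-suc {x = suc zero} {zero}  {suc zero} p q = ⊥-elim (q refl)
  adj-punchIn-suc {x = suc (suc x)} {zero}  {suc zero} p q = refl
  adj-punchIn-suc {x = suc zero} {zero}  {suc (suc b)} p q = refl
  adj-punchIn-suc {x = suc (suc x)} {zero}  {suc (suc b)} p q = refl
  adj-punchIn-suc {x = suc zero} {suc zero}  {zero} p q = ⊥-elim (p refl)
  adj-punchIn-suc {x = suc (suc x)} {suc zero}  {zero} p q = refl
  adj-punchIn-suc {x = suc zero} {suc (suc a)}  {zero} p q = refl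
  adj-punchIn-suc {x = suc (suc x)} {suc (suc a)}  {zero} p q = refl
  adj-punchIn-suc {x = suc x} {suc a} {suc b} p q =
    adj-punchIn-suc {x = x} {a} {b} (p ∘ cong suc) (q ∘ cong suc)

  -- An insertion directly beside `x` can separate only a pair that contains `x`.
  adj-punchIn : ∀ {n} {g : Fin (suc n)} {x a b : Fin n} → g NextTo x → a ≢ x → b ≢ x →
    adj (punchIn g a) (punchIn g b) ≡ adj a b
  adj-punchIn (inj₁ refl) = adj-punchIn-inject₁
  adj-punchIn (inj₂ refl) = adj-punchIn-suc

  -- If `v` is consecutive to `z`, it lies on one side of `z`: inserting on that side separates
  -- them, inserting on the other side does not.
  adj-punchIn-either : ∀ {n} (z v : Fin n) →
    adj (punchIn (inject₁ z) z) (punchIn (inject₁ z) v) + adj (punchIn (suc z) z) (punchIn (suc z) v) ≡ adj z v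
  adj-punchIn-either zero    zero    = refl
  adj-punchIn-either zero    (suc v) = ℕₚ.+-identityʳ _
  adj-punchIn-either (suc zero) zero    = refl
  adj-punchIn-either (suc (suc z)) zero    = refl
  adj-punchIn-either (suc z) (suc v) = adj-punchIn-either z v

  gap-nextTo : ∀ {n} (x z : Fin n) → adj x z ≢ 0 → gap x z NextTo x
  gap-nextTo zero    zero          a = inj₁ refl
  gap-nextTo zero    (suc zero)    a = inj₂ refl
  gap-nextTo zero    (suc (suc z)) a = ⊥-elim (a refl)
  gap-nextTo (suc x) zero          a = inj₁ refl
  gap-nextTo (suc x) (suc z)       a with gap-nextTo x z a
  ... | inj₁ e = inj₁ (cong suc e)
  ... | inj₂ e = inj₂ (cong suc e)

  -- Words that satisfy a set of marks.

  private
    variable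
      n k : ℕ

  lead : Fin n → Vec (Fin n) k → ℕ
  lead x []          = 0
  lead x (_ ∷ [])    = 0
  lead x (_ ∷ y ∷ _) = adj x y

  mark : Bool → Fin n → Vec (Fin n) k → ℕ
  mark false x w = 1
  mark true  x w = lead x w

  -- The indicator, with values 0 and 1, that the word meets all requirements of the marks. A mark
  -- without a partner gives 0 through `lead`.
  χ : Vec Bool k → Vec (Fin n) k → ℕ
  χ []      []      = 1
  χ (b ∷ M) (x ∷ w) = mark b x w * χ M w

  _∉_ : Fin n → Vec (Fin n) k → Set
  x ∉ w = ∀ i → lookup w i ≢ x

  mark-punchIn : ∀ {g : Fin (suc n)} {x a} → g NextTo x → a ≢ x → ∀ b y (w : Vec (Fin n) k) → x ∉ w →
    mark b (punchIn g a) (Vec.map (punchIn g) (y ∷ w)) ≡ mark b a (y ∷ w)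
  mark-punchIn g∼x a≢x false y w       x∉w = refl
  mark-punchIn g∼x a≢x true  y []      x∉w = refl
  mark-punchIn g∼x a≢x true  y (_ ∷ _) x∉w = adj-punchIn g∼x a≢x (x∉w zero)

  χ-punchIn : ∀ {g : Fin (suc n)} {x} → g NextTo x → (M : Vec Bool k) (w : Vec (Fin n) k) → x ∉ w →
    χ M (Vec.map (punchIn g) w) ≡ χ M w
  χ-punchIn g∼x []      []      x∉w = refl
  χ-punchIn g∼x (false ∷ [])      (a ∷ [])     x∉w = refl
  χ-punchIn g∼x (true ∷ [])      (a ∷ [])     x∉w = refl
  χ-punchIn g∼x (b ∷ M) (a ∷ y ∷ w) x∉w = cong₂ _*_
    (mark-punchIn g∼x (x∉w zero) b y w (λ i → x∉w (suc (suc i))))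
    (χ-punchIn g∼x M (y ∷ w) (x∉w ∘ suc))

  private
    sum-const : ∀ n c → sum {n} (λ _ → c) ≡ n * c
    sum-const zero    c = refl
    sum-const (suc n) c = cong (c +_) (sum-const n c)

  Inj : Vec (Fin n) k → Set
  Inj w = Injective _≡_ _≡_ (lookup w)

  Inj-tail : ∀ {x} {w : Vec (Fin n) k} → Inj (x ∷ w) → Inj w
  Inj-tail inj = suc-injective ∘ inj

  Inj-head : ∀ {x} {w : Vec (Fin n) k} → Inj (x ∷ w) → x ∉ w
  Inj-head inj i wᵢ≡x with () ← inj {suc i} {zero} wᵢ≡x

  -- Allows an equation about `gap x z` to be used under the factor `adj x z`, without which the gap
  -- has no meaning.
  adj*-cong : ∀ (x z : Fin n) {a b} → (adj x z ≢ 0 → a ≡ b) → adj x z * a ≡ adj x z * b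
  adj*-cong x z a≡b with adj x z
  ... | zero  = refl
  ... | suc c = cong (suc c *_) (a≡b λ ())

  -- A new first digit must avoid the gap of every marked pair, and the gaps
  -- of different pairs are different.
  χ-unmarked-sum : (M : Vec Bool k) (w : Vec (Fin n) k) → Inj w →
    sum (λ d → χ M (Vec.map (punchIn d) w)) + #true M * χ M w ≡ suc n * χ M w
  χ-unmarked-sum {n = n} [] [] inj = trans (ℕₚ.+-identityʳ _) (sum-const (suc n) 1)
  χ-unmarked-sum {n = n} (false ∷ M) (x ∷ w) inj = begin
    sum (λ d → 1 * χ M (Vec.map (punchIn d) w)) + #true M * (1 * χ M w)
      ≡⟨ cong₂ (λ a b → a + #true M * b) (sum-cong-≗ {suc n} (λ d → ℕₚ.*-identityˡ (χ M (Vec.map (punchIn d) w)))) (ℕₚ.*-identityˡ _) ⟩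
    sum (λ d → χ M (Vec.map (punchIn d) w)) + #true M * χ M w
      ≡⟨ χ-unmarked-sum M w (Inj-tail inj) ⟩
    suc n * χ M w
      ≡⟨ cong (suc n *_) (ℕₚ.*-identityˡ _) ⟨
    suc n * (1 * χ M w) ∎
  χ-unmarked-sum {n = n} (true ∷ M) (x ∷ []) inj = trans
    (cong₂ _+_ (sum-replicate-zero (suc n)) (ℕₚ.*-zeroʳ (suc (#true M)))) (sym (ℕₚ.*-zeroʳ (suc n)))
  χ-unmarked-sum {n = n} (true ∷ M) (x ∷ _ ∷ []) inj = trans
    (cong₂ _+_ (sum-replicate-zero (suc n)) (ℕₚ.*-zeroʳ (suc (#true M)))) (sym (ℕₚ.*-zeroʳ (suc n)))
  χ-unmarked-sum {n = n} (true ∷ M) (x ∷ w@(y ∷ z ∷ _)) inj = begin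
    r + suc m * (a * X)        ≡⟨ solve 4 (λ r m a X → r :+ (con 1 :+ m) :* (a :* X) := (r :+ a :* X) :+ a :* (m :* X)) refl r m a X ⟩
    (r + a * X) + a * (m * X)  ≡⟨ cong (λ c → (r + c) + a * (m * X)) (adj*-cong x z F-gap) ⟨
    (r + a * F (gap x z)) + a * (m * X) ≡⟨ cong (_+ a * (m * X)) (adj-punchIn-sum x z F) ⟩
    a * sum F + a * (m * X)    ≡⟨ ℕₚ.*-distribˡ-+ a (sum F) (m * X) ⟨
    a * (sum F + m * X)        ≡⟨ cong (a *_) (χ-unmarked-sum M w (Inj-tail inj)) ⟩
    a * (suc n * X)            ≡⟨ solve 3 (λ a s X → a :* (s :* X) := s :* (a :* X)) refl a (suc n) X ⟩
    suc n * (a * X)            ∎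
    where
    F = λ d → χ M (Vec.map (punchIn d) w)
    X = χ M w
    a = adj x z
    m = #true M
    r = sum (λ d → adj (punchIn d x) (punchIn d z) * F d)
    -- The gap lies beside `x`, and by injectivity `x` does not occur in `w`; hence the value
    -- excluded by this pair is harmless for all later marks.
    F-gap : adj x z ≢ 0 → F (gap x z) ≡ X
    F-gap a≢0 = χ-punchIn (gap-nextTo x z a≢0) M w (Inj-head inj)

  -- The origin of `joins`: if `z` is not tied to a later digit, both sides of `z` are available; if
  -- it is tied, its partner blocks one of them.
  mark-either : ∀ m b (z : Fin n) (w : Vec (Fin n) k) →
    mark b (punchIn (inject₁ z) z) (Vec.map (punchIn (inject₁ z)) w) +
    mark b (punchIn (suc z) z) (Vec.map (punchIn (suc z)) w) ≡ joins (suc m) b * mark b z w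
  mark-either m false z w = refl
  mark-either m true  z [] = refl
  mark-either m true  z (_ ∷ []) = refl
  mark-either m true  z (_ ∷ v ∷ _) = trans (adj-punchIn-either z v) (sym (ℕₚ.*-identityˡ _))

  -- The new digit must go directly below or above the digit `z` two places on. The mark at `y` and
  -- the marks after `z` concern pairs without `z` and survive both insertions, so only the mark at
  -- `z` itself affects the count. Without a `z` both sides vanish.
  χ-marked-sum : (M : Vec Bool k) (w : Vec (Fin n) k) → Inj w →
    sum (λ d → lead d (Vec.map (punchIn d) w) * χ M (Vec.map (punchIn d) w)) ≡ joins ⌊ k /2⌋ (second M) * χ M w
  χ-marked-sum {n = n} []       []       inj = sum-replicate-zero (suc n)
  χ-marked-sum {n = n} (_ ∷ []) (_ ∷ []) inj = sum-replicate-zero (suc n)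
  χ-marked-sum {k = suc (suc k)} (b ∷ b′ ∷ M) w₀@(y ∷ z ∷ w) inj = begin
    sum (λ d → adj d (punchIn d z) * F d) ≡⟨ adj-punchIn-self-sum z F ⟩
    F (inject₁ z) + F (suc z)             ≡⟨ cong₂ _+_ (F-nextTo (inj₁ refl)) (F-nextTo (inj₂ refl)) ⟩
    c * (ℓ (inject₁ z) * X) + c * (ℓ (suc z) * X)
      ≡⟨ solve 4 (λ c l l′ X → c :* (l :* X) :+ c :* (l′ :* X) := c :* ((l :+ l′) :* X)) refl c (ℓ (inject₁ z)) (ℓ (suc z)) X ⟩
    c * ((ℓ (inject₁ z) + ℓ (suc z)) * X) ≡⟨ cong (λ e → c * (e * X)) (mark-either ⌊ k /2⌋ b′ z w) ⟩
    c * ((joins (suc ⌊ k /2⌋) b′ * mark b′ z w) * X)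
      ≡⟨ solve 4 (λ c j l X → c :* ((j :* l) :* X) := j :* (c :* (l :* X))) refl c (joins (suc ⌊ k /2⌋) b′) (mark b′ z w) X ⟩
    joins (suc ⌊ k /2⌋) b′ * (c * (mark b′ z w * X))  ∎
    where
    F = λ d → χ (b ∷ b′ ∷ M) (Vec.map (punchIn d) w₀)
    X = χ M w
    c = mark b y (z ∷ w)
    ℓ = λ d → mark b′ (punchIn d z) (Vec.map (punchIn d) w)
    z∉w : z ∉ w
    z∉w = Inj-head (Inj-tail inj)
    F-nextTo : ∀ {g} → g NextTo z → F g ≡ c * (ℓ g * X)
    F-nextTo {g} g∼z = cong₂ (λ e f → e * (ℓ g * f))
      (mark-punchIn g∼z (λ y≡z → Inj-head inj zero (sym y≡z)) b z w z∉w)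
      (χ-punchIn g∼z M w z∉w)

  -- Listing the permutations by their first digit.

  private
    variable
      A B C D : Set

  filter-map : ∀ {P : Pred B 0ℓ} (P? : Decidable P) (f : A → B) xs →
    filter P? (List.map f xs) ≡ List.map f (filter (P? ∘ f) xs)
  filter-map P? f []       = refl
  filter-map P? f (x ∷ xs) with P? (f x)
  ... | yes _ = cong (f x ∷_) (filter-map P? f xs)
  ... | no  _ = filter-map P? f xs

  filter-cartesianProductWith : ∀ {P : Pred C 0ℓ} (P? : Decidable P) {f : A → B → C} {g : A → D → C} {ys zs} →
    (∀ x → filter P? (List.map (f x) ys) ≡ List.map (g x) zs) →
    ∀ xs → filter P? (cartesianProductWith f xs ys) ≡ cartesianProductWith g xs zs
  filter-cartesianProductWith P? eq []       = refl
  filter-cartesianProductWith P? {f} {ys = ys} eq (x ∷ xs) =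
    trans (filter-++ P? (List.map (f x) ys) _) (cong₂ _++_ (eq x) (filter-cartesianProductWith P? eq xs))

  cartesianProductWith-map : ∀ {A′ B′ C′ : Set} {f : A′ → B′ → C′} {f′ : A → B → C} {a : A → A′} {b : B → B′} {c : C → C′} →
    (∀ x y → f (a x) (b y) ≡ c (f′ x y)) →
    ∀ xs ys → cartesianProductWith f (List.map a xs) (List.map b ys) ≡ List.map c (cartesianProductWith f′ xs ys)
  cartesianProductWith-map eq [] ys = refl
  cartesianProductWith-map {f′ = f′} {c = c} eq (x ∷ xs) ys = trans
    (cong₂ _++_ (trans (sym (map-∘ ys)) (trans (map-cong (eq x) ys) (map-∘ ys)))
                (cartesianProductWith-map eq xs ys))
    (sym (map-++ c (List.map (f′ x) ys) _))

  allFin-suc : ∀ n → tabulate {n = n} Fin.suc ≡ List.map Fin.suc (allFin n)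
  allFin-suc n = sym (map-tabulate id Fin.suc)

  filter-≢-allFin : ∀ (d : Fin (suc n)) → filter (λ x → ¬? (x ≟ d)) (allFin (suc n)) ≡ List.map (punchIn d) (allFin n)
  filter-≢-allFin {n} zero = trans (filter-all (λ x → ¬? (x ≟ zero)) (tabulate⁺ {n = n} λ _ ())) (allFin-suc n)
  filter-≢-allFin {suc n} (suc d) = cong (zero ∷_) (begin
    filter (λ x → ¬? (x ≟ suc d)) (tabulate suc)
      ≡⟨ cong (filter (λ x → ¬? (x ≟ suc d))) (allFin-suc (suc n)) ⟩
    filter (λ x → ¬? (x ≟ suc d)) (List.map suc (allFin (suc n)))
      ≡⟨ filter-map (λ x → ¬? (x ≟ suc d)) suc (allFin (suc n)) ⟩
    List.map suc (filter (λ x → ¬? (suc x ≟ suc d)) (allFin (suc n)))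
      ≡⟨ cong (List.map suc) (filter-≐ (λ x → ¬? (suc x ≟ suc d)) (λ x → ¬? (x ≟ d))
           ((λ p → p ∘ cong suc) , (λ p → p ∘ suc-injective)) (allFin (suc n))) ⟩
    List.map suc (filter (λ x → ¬? (x ≟ d)) (allFin (suc n)))
      ≡⟨ cong (List.map suc) (filter-≢-allFin d) ⟩
    List.map suc (List.map (punchIn d) (allFin n))
      ≡⟨ trans (sym (map-∘ (allFin n))) (map-∘ (allFin n)) ⟩
    List.map (punchIn (suc d)) (List.map suc (allFin n))
      ≡⟨ cong (List.map (punchIn (suc d))) (allFin-suc n) ⟨
    List.map (punchIn (suc d)) (tabulate suc) ∎)

  _∉?_ : (d : Fin n) (w : Vec (Fin n) k) → Dec (d ∉ w)
  d ∉? w = all? λ i → ¬? (lookup w i ≟ d)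

  filter-∉-∷ : ∀ (d : Fin n) xs (ws : List (Vec (Fin n) k)) →
    filter (d ∉?_) (cartesianProductWith _∷_ xs ws) ≡
    cartesianProductWith _∷_ (filter (λ x → ¬? (x ≟ d)) xs) (filter (d ∉?_) ws)
  filter-∉-∷ d [] ws = refl
  filter-∉-∷ d (x ∷ xs) ws with x ≟ d
  ... | yes x≡d = trans (filter-++ (d ∉?_) (List.map (x ∷_) ws) _)
    (cong₂ _++_ (filter-none (d ∉?_) (map⁺ (All.universal (λ w p → p zero x≡d) ws))) (filter-∉-∷ d xs ws))
  ... | no x≢d = trans (filter-++ (d ∉?_) (List.map (x ∷_) ws) _)
    (cong₂ _++_ (trans (filter-map (d ∉?_) (x ∷_) ws) (cong (List.map (x ∷_))
      (filter-≐ (λ w → d ∉? (x ∷ w)) (d ∉?_) ((λ p → p ∘ suc) , λ { p zero → x≢d ; p (suc i) → p i }) ws)))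
      (filter-∉-∷ d xs ws))

  -- `punchIn d` is increasing with image all digits except `d`, so relabelling respects the
  -- lexicographic order and the two lists agree entry by entry.
  filter-∉-words : ∀ (d : Fin (suc n)) k → filter (d ∉?_) (words (suc n) k) ≡ List.map (Vec.map (punchIn d)) (words n k)
  filter-∉-words d zero = refl
  filter-∉-words {n} d (suc k) = begin
    filter (d ∉?_) (words (suc n) (suc k))
      ≡⟨ filter-∉-∷ d (allFin (suc n)) (words (suc n) k) ⟩
    cartesianProductWith _∷_ (filter (λ x → ¬? (x ≟ d)) (allFin (suc n))) (filter (d ∉?_) (words (suc n) k))
      ≡⟨ cong₂ (cartesianProductWith _∷_) (filter-≢-allFin d) (filter-∉-words d k) ⟩
    cartesianProductWith _∷_ (List.map (punchIn d) (allFin n)) (List.map (Vec.map (punchIn d)) (words n k))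
      ≡⟨ cartesianProductWith-map (λ _ _ → refl) (allFin n) (words n k) ⟩
    List.map (Vec.map (punchIn d)) (words n (suc k)) ∎

  Inj? : Decidable (Inj {n} {k})
  Inj? w = map′ (λ inj {x} {y} → inj x y) (λ inj x y → inj {x} {y})
    (all? λ x → all? λ y → (lookup w x ≟ lookup w y) →-dec (x ≟ y))

  Inj-∷ : ∀ {d : Fin n} {w : Vec (Fin n) k} → d ∉ w → Inj w → Inj (d ∷ w)
  Inj-∷ d∉w inj {zero}  {zero}  e = refl
  Inj-∷ d∉w inj {zero}  {suc y} e = contradiction (sym e) (d∉w y)
  Inj-∷ d∉w inj {suc x} {zero}  e = contradiction e (d∉w x)
  Inj-∷ d∉w inj {suc x} {suc y} e = cong suc (inj e)

  filter-filter : ∀ {P Q R : Pred A 0ℓ} (P? : Decidable P) (Q? : Decidable Q) (R? : Decidable R) →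
    (∀ {x} → R x → P x × Q x) → (∀ {x} → P x → Q x → R x) →
    ∀ xs → filter R? xs ≡ filter Q? (filter P? xs)
  filter-filter P? Q? R? split join [] = refl
  filter-filter P? Q? R? split join (x ∷ xs) with P? x
  ... | no ¬p = trans (filter-reject R? (¬p ∘ proj₁ ∘ split)) (filter-filter P? Q? R? split join xs)
  ... | yes p with Q? x
  ...   | yes q = trans (filter-accept R? (join p q)) (cong (x ∷_) (filter-filter P? Q? R? split join xs))
  ...   | no ¬q = trans (filter-reject R? (¬q ∘ proj₂ ∘ split)) (filter-filter P? Q? R? split join xs)

  insertFirst : Fin (suc n) → Vec (Fin n) k → Vec (Fin (suc n)) (suc k)
  insertFirst d w = d ∷ Vec.map (punchIn d) w

  Inj-map-punchIn : ∀ (d : Fin (suc n)) → (Inj {k = k} ∘ Vec.map (punchIn d)) ≐ Inj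
  Inj-map-punchIn d =
    (λ {w} inj {x} {y} e → inj (trans (lookup-map x (punchIn d) w) (trans (cong (punchIn d) e) (sym (lookup-map y (punchIn d) w))))) ,
    (λ {w} inj {x} {y} e → inj (punchIn-injective d _ _ (trans (sym (lookup-map x (punchIn d) w)) (trans e (lookup-map y (punchIn d) w)))))

  filter-Inj-words : ∀ n k → filter Inj? (words (suc n) (suc k)) ≡
    cartesianProductWith insertFirst (allFin (suc n)) (filter Inj? (words n k))
  filter-Inj-words n k = filter-cartesianProductWith Inj? {f = _∷_} {ys = words (suc n) k} step (allFin (suc n))
    where
    step : ∀ d → filter Inj? (List.map (d ∷_) (words (suc n) k)) ≡ List.map (insertFirst d) (filter Inj? (words n k))
    step d = begin
      filter Inj? (List.map (d ∷_) (words (suc n) k))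
        ≡⟨ filter-map Inj? (d ∷_) (words (suc n) k) ⟩
      List.map (d ∷_) (filter (λ w → Inj? (d ∷ w)) (words (suc n) k))
        ≡⟨ cong (List.map (d ∷_)) (filter-filter (d ∉?_) Inj? (λ w → Inj? (d ∷ w))
             (λ inj → Inj-head inj , Inj-tail inj) Inj-∷ (words (suc n) k)) ⟩
      List.map (d ∷_) (filter Inj? (filter (d ∉?_) (words (suc n) k)))
        ≡⟨ cong (List.map (d ∷_) ∘ filter Inj?) (filter-∉-words d k) ⟩
      List.map (d ∷_) (filter Inj? (List.map (Vec.map (punchIn d)) (words n k)))
        ≡⟨ cong (List.map (d ∷_)) (filter-map Inj? (Vec.map (punchIn d)) (words n k)) ⟩
      List.map (d ∷_) (List.map (Vec.map (punchIn d)) (filter (λ w → Inj? (Vec.map (punchIn d) w)) (words n k)))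
        ≡⟨ map-∘ _ ⟨
      List.map (insertFirst d) (filter (λ w → Inj? (Vec.map (punchIn d) w)) (words n k))
        ≡⟨ cong (List.map (insertFirst d)) (filter-≐ (λ w → Inj? (Vec.map (punchIn d) w)) Inj? (Inj-map-punchIn d) (words n k)) ⟩
      List.map (insertFirst d) (filter Inj? (words n k)) ∎

  -- Pigeonhole principle: punching out a missed value would inject `Fin (suc n)` into `Fin n`.
  injective⇒strictlySurjective : ∀ {f : Fin n → Fin n} → Injective _≡_ _≡_ f → StrictlySurjective _≡_ f
  injective⇒strictlySurjective {suc n} {f} inj y with any? (λ x → f x ≟ y)
  ... | yes hit = hit
  ... | no miss = contradiction
    (injective⇒≤ {f = λ x → punchOut (y≢f x)} λ e → inj (punchOut-injective (y≢f _) (y≢f _) e)) ℕₚ.1+n≰n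
    where
    y≢f : ∀ x → y ≢ f x
    y≢f x y≡fx = miss (x , sym y≡fx)

  -- Injectivity, unlike bijectivity, passes to the tail of a word, where length and alphabet differ
  -- in size.
  S≡filter-Inj : ∀ n → S n ≡ filter Inj? (words n n)
  S≡filter-Inj n = filter-≐ isPermutation? Inj?
    (proj₁ , λ inj → inj , strictlySurjective⇒surjective (injective⇒strictlySurjective inj)) (words n n)

  S-suc : ∀ n → S (suc n) ≡ cartesianProductWith insertFirst (allFin (suc n)) (S n)
  S-suc n = begin
    S (suc n) ≡⟨ S≡filter-Inj (suc n) ⟩
    filter Inj? (words (suc n) (suc n)) ≡⟨ filter-Inj-words n n ⟩
    cartesianProductWith insertFirst (allFin (suc n)) (filter Inj? (words n n))
      ≡⟨ cong (cartesianProductWith insertFirst (allFin (suc n))) (S≡filter-Inj n) ⟨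
    cartesianProductWith insertFirst (allFin (suc n)) (S n) ∎

  S-Inj : ∀ n → All Inj (S n)
  S-Inj n = All.map proj₁ (all-filter isPermutation? (words n n))

  -- Vertical separators as a sum over positions.

  leads : Vec (Fin n) k → ℕ
  leads []      = 0
  leads (x ∷ w) = lead x w + leads w

  -- `IsVerticalSeparator` for words whose length may differ from the size of the alphabet, as
  -- happens for tails.
  Separates : Vec (Fin n) k → Fin k → Set
  Separates w i = ∃₂ λ j k →
    suc (toℕ j) ≡ toℕ i × suc (toℕ i) ≡ toℕ k ×
    ∣ toℕ (lookup w j) - toℕ (lookup w k) ∣ ≡ 1

  ~≡1 : ∀ a b → ∣ a - b ∣ ≡ 1 → a ~ b ≡ 1
  ~≡1 zero (suc zero) e = refl
  ~≡1 (suc zero) zero e = refl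
  ~≡1 (suc a) (suc b) e = ~≡1 a b e

  ~≡0 : ∀ a b → ∣ a - b ∣ ≢ 1 → a ~ b ≡ 0
  ~≡0 zero          zero          p = refl
  ~≡0 zero          (suc zero)    p = contradiction refl p
  ~≡0 zero          (suc (suc b)) p = refl
  ~≡0 (suc zero)    zero          p = contradiction refl p
  ~≡0 (suc (suc a)) zero          p = refl
  ~≡0 (suc a)       (suc b)       p = ~≡0 a b p

  Separates-suc : ∀ {x} {w : Vec (Fin n) (suc k)} →
    (λ i → Separates (x ∷ w) (suc (suc i))) ≐ (λ i → Separates w (suc i))
  Separates-suc =
    (λ { (suc j , suc k , p , q , r) → j , k , ℕₚ.suc-injective p , ℕₚ.suc-injective q , r }) ,
    (λ { (j , k , p , q , r) → suc j , suc k , cong suc p , cong suc q , r })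

  Separates-1⇒lead≡1 : ∀ {x} {w : Vec (Fin n) (suc k)} → Separates (x ∷ w) (suc zero) → lead x w ≡ 1
  Separates-1⇒lead≡1 {x = x} {_ ∷ z ∷ _} (zero , suc (suc zero) , _ , _ , r) = ~≡1 (toℕ x) (toℕ z) r

  ¬Separates-1⇒lead≡0 : ∀ {x} {w : Vec (Fin n) (suc k)} → ¬ Separates (x ∷ w) (suc zero) → lead x w ≡ 0
  ¬Separates-1⇒lead≡0 {w = _ ∷ []} ¬s = refl
  ¬Separates-1⇒lead≡0 {x = x} {_ ∷ z ∷ _} ¬s =
    ~≡0 (toℕ x) (toℕ z) λ r → ¬s (zero , suc (suc zero) , refl , refl , r)

  -- `P` and `f` are arbitrary because the recursion keeps the predicate and replaces the
  -- enumeration `f` by `f ∘ suc`, while the word loses its head.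
  length-filter-Separates : ∀ {P : Pred A 0ℓ} (P? : Decidable P) x (w : Vec (Fin n) k) (f : Fin k → A) →
    (P ∘ f) ≐ (λ i → Separates (x ∷ w) (suc i)) → length (filter P? (tabulate f)) ≡ leads (x ∷ w)
  length-filter-Separates P? x []      f P≐S = refl
  length-filter-Separates P? x (y ∷ w) f P≐S with P? (f zero)
  ... | yes p = cong₂ _+_ (sym (Separates-1⇒lead≡1 (proj₁ P≐S p))) (length-filter-Separates P? y w (f ∘ suc)
    (proj₁ Separates-suc ∘ proj₁ P≐S , proj₂ P≐S ∘ proj₂ Separates-suc))
  ... | no ¬p = cong₂ _+_ (sym (¬Separates-1⇒lead≡0 (¬p ∘ proj₂ P≐S))) (length-filter-Separates P? y w (f ∘ suc)
    (proj₁ Separates-suc ∘ proj₁ P≐S , proj₂ P≐S ∘ proj₂ Separates-suc))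

  separators≡leads : (π : Vec (Fin n) n) → separators π ≡ leads π
  separators≡leads []      = refl
  separators≡leads π@(x ∷ w) = trans
    -- The first position has no left neighbour and drops out. A separator at any later position is
    -- recorded by `lead` one place to its left, where the corresponding mark sits.
    (cong length (filter-reject (isVerticalSeparator? π) {zero} λ { (_ , _ , () , _) }))
    (length-filter-Separates (isVerticalSeparator? π) x w suc (id , id))

open Words

-- The number of permutations that satisfy given marks.

private module ℕΣ = Sum ℕₚ.+-*-semiring

#true+#false : ∀ {n} (M : Vec Bool n) → #true M +ₙ #false M ≡ n
#true+#false []          = ≡.refl
#true+#false (false ∷ M) = ≡.trans (ℕₚ.+-suc _ _) (≡.cong suc (#true+#false M))
#true+#false (true  ∷ M) = ≡.cong suc (#true+#false M)

-- Of the n + 1 values for the new digit, the `#true M` gaps are forbidden. Cancelling them leaves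
-- `suc (#false M)`, the number of places for a new block among the old ones.
χ-false-sum : ∀ {n} (M : Vec Bool n) (w : Vec (Fin n) n) → Inj w →
  ℕΣ.sum (λ d → χ (false ∷ M) (insertFirst d w)) ≡ suc (#false M) *ₙ χ M w
χ-false-sum {n} M w inj = ℕₚ.+-cancelʳ-≡ (#true M *ₙ χ M w) _ _ (begin
  ℕΣ.sum (λ d → 1 *ₙ χ M (Vec.map (punchIn d) w)) +ₙ #true M *ₙ χ M w
    ≡⟨ ≡.cong (_+ₙ #true M *ₙ χ M w) (ℕΣ.sum-cong-≗ {suc n} (λ d → ℕₚ.*-identityˡ (χ M (Vec.map (punchIn d) w)))) ⟩
  ℕΣ.sum (λ d → χ M (Vec.map (punchIn d) w)) +ₙ #true M *ₙ χ M w ≡⟨ χ-unmarked-sum M w inj ⟩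
  suc n *ₙ χ M w ≡⟨ ≡.cong (λ m → suc m *ₙ χ M w) (#true+#false M) ⟨
  suc (#true M +ₙ #false M) *ₙ χ M w
    ≡⟨ solve 3 (λ a b c → (con 1 :+ (a :+ b)) :* c := (con 1 :+ b) :* c :+ a :* c) ≡.refl (#true M) (#false M) (χ M w) ⟩
  suc (#false M) *ₙ χ M w +ₙ #true M *ₙ χ M w ∎)
  where
  open ≡.≡-Reasoning
  open +-*-Solver

extensions : ∀ {n} → Bool → Vec Bool n → ℕ
extensions false M = suc (#false M)
extensions {n} true M = joins ⌊ n /2⌋ (second M)

χ-sum : ∀ {n} b (M : Vec Bool n) (w : Vec (Fin n) n) → Inj w →
  ℕΣ.sum (λ d → χ (b ∷ M) (insertFirst d w)) ≡ extensions b M *ₙ χ M w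
χ-sum false = χ-false-sum
χ-sum true  = χ-marked-sum

-- The number b! 2^r: when all marks have partners, each block has just one unmarked position, its
-- last, so `#false M` counts the blocks.
placements : ∀ {n} → Vec Bool n → ℕ
placements M = (#false M) ! *ₙ orientations M

placements-∷ : ∀ {n} b (M : Vec Bool n) → placements (b ∷ M) ≡ placements M *ₙ extensions b M
placements-∷ false M = solve 3 (λ f g o → (f :* g) :* o := (g :* o) :* f) ≡.refl (suc (#false M)) ((#false M) !) (orientations M)
  where open +-*-Solver
placements-∷ true  M = solve 3 (λ f j o → f :* (j :* o) := (f :* o) :* j) ≡.refl ((#false M) !) (extensions true M) (orientations M)
  where open +-*-Solver

lead-0-1 : ∀ {n k} (x : Fin n) (w : Vec (Fin n) k) → lead x w ≡ 0 ⊎ lead x w ≡ 1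
lead-0-1 x []          = inj₁ ≡.refl
lead-0-1 x (_ ∷ [])    = inj₁ ≡.refl
lead-0-1 x (_ ∷ y ∷ _) = go (toℕ x) (toℕ y)
  where
  go : ∀ a b → a ~ b ≡ 0 ⊎ a ~ b ≡ 1
  go zero          zero          = inj₁ ≡.refl
  go zero          (suc zero)    = inj₂ ≡.refl
  go zero          (suc (suc b)) = inj₁ ≡.refl
  go (suc a)       (suc b)       = go a b
  go (suc zero)    zero          = inj₂ ≡.refl
  go (suc (suc a)) zero          = inj₁ ≡.refl

-- The Kronecker delta, by recursion on both arguments so that `sum-δ` can peel off one index at a
-- time.
δ : ℕ → ℕ → ℕ
δ zero    zero    = 1
δ zero    (suc _) = 0
δ (suc _) zero    = 0
δ (suc a) (suc b) = δ a b

δ-refl : ∀ a → δ a a ≡ 1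
δ-refl zero    = ≡.refl
δ-refl (suc a) = δ-refl a

δ-≢ : ∀ a b → a ≢ b → δ a b ≡ 0
δ-≢ zero    zero    a≢b = contradiction ≡.refl a≢b
δ-≢ zero    (suc b) a≢b = ≡.refl
δ-≢ (suc a) zero    a≢b = ≡.refl
δ-≢ (suc a) (suc b) a≢b = δ-≢ a b (a≢b ∘ ≡.cong suc)

-- The commutative ring of formal power series.

module PowerSeries {c ℓ} (R : CommutativeRing c ℓ) where
  open CommutativeRing R hiding (zero)
  open import Relation.Binary.Reasoning.Setoid setoid
  open import Algebra.Properties.Semiring.Sum semiring using (sum; sum-cong-≋; sum-replicate-zero)
  open import Algebra.Properties.CommutativeSemigroup +-commutativeSemigroup using (interchange; x∙yz≈y∙xz)

  infixl 7 _✶_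
  _✶_ : Series rawRing → Series rawRing → Series rawRing
  _✶_ = RawRing._*_ (powerSeries rawRing)

  infix 4 _≈ˢ_
  _≈ˢ_ : Series rawRing → Series rawRing → Set ℓ
  f ≈ˢ g = ∀ n → f n ≈ g n

  ✶-cong : ∀ {f f′ g g′} → f ≈ˢ f′ → g ≈ˢ g′ → f ✶ g ≈ˢ f′ ✶ g′
  ✶-cong p q n = sum-cong-≋ {suc n} λ k → *-cong (p (toℕ k)) (q (n ∸ toℕ k))

  zero-✶ : ∀ {f} → (∀ n → f n ≈ 0#) → ∀ g n → (f ✶ g) n ≈ 0#
  zero-✶ {f} p g n = trans
    (sum-cong-≋ {suc n} λ k → trans (*-congʳ (p (toℕ k))) (zeroˡ (g (n ∸ toℕ k))))
    (sum-replicate-zero (suc n))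

  const-✶ : ∀ a f n → (const rawRing a ✶ f) n ≈ a * f n
  const-✶ a f zero    = +-identityʳ _
  const-✶ a f (suc n) = trans (+-congˡ (zero-✶ (λ _ → refl) f n)) (+-identityʳ _)

  ✶-distribʳ : ∀ f g h → (λ n → g n + h n) ✶ f ≈ˢ (λ n → (g ✶ f) n + (h ✶ f) n)
  ✶-distribʳ f g h zero    = trans (+-congʳ (distribʳ _ _ _))
    (trans (+-cong refl (sym (+-identityʳ 0#))) (interchange _ _ _ _))
  ✶-distribʳ f g h (suc n) = trans
    (+-cong (distribʳ _ _ _) (✶-distribʳ f (g ∘ suc) (h ∘ suc) n)) (interchange _ _ _ _)

  scale-✶ : ∀ a f g n → ((λ n → a * f n) ✶ g) n ≈ a * (f ✶ g) n
  scale-✶ a f g zero    = begin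
    a * f 0 * g 0 + 0#       ≈⟨ +-cong (*-assoc _ _ _) (sym (zeroʳ a)) ⟩
    a * (f 0 * g 0) + a * 0# ≈⟨ distribˡ _ _ _ ⟨
    a * (f 0 * g 0 + 0#)     ∎
  scale-✶ a f g (suc n) = trans (+-cong (*-assoc _ _ _) (scale-✶ a (f ∘ suc) g n)) (sym (distribˡ _ _ _))

  -- Splits off the last term of the convolution, whereas unfolding splits off the first; comparing
  -- the two gives commutativity.
  ✶-suc : ∀ f g n → (f ✶ g) (suc n) ≈ f (suc n) * g 0 + (f ✶ (g ∘ suc)) n
  ✶-suc f g zero    = x∙yz≈y∙xz _ _ _
  ✶-suc f g (suc n) = trans (+-congˡ (✶-suc (f ∘ suc) g n)) (x∙yz≈y∙xz _ _ _)

  ✶-comm : ∀ f g → f ✶ g ≈ˢ g ✶ f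
  ✶-comm f g zero    = +-congʳ (*-comm _ _)
  ✶-comm f g (suc n) = trans (+-cong (*-comm _ _) (✶-comm (f ∘ suc) g n)) (sym (✶-suc g f n))

  ✶-assoc : ∀ f g h → (f ✶ g) ✶ h ≈ˢ f ✶ (g ✶ h)
  ✶-assoc f g h zero    = +-congʳ (begin
    (f 0 * g 0 + 0#) * h 0 ≈⟨ *-congʳ (+-identityʳ _) ⟩
    f 0 * g 0 * h 0        ≈⟨ *-assoc _ _ _ ⟩
    f 0 * (g 0 * h 0)      ≈⟨ *-congˡ (+-identityʳ _) ⟨
    f 0 * (g 0 * h 0 + 0#) ∎)
  ✶-assoc f g h (suc n) = begin
    -- The shifted product `(f ✶ g) ∘ suc` unfolds to `f 0 * g (suc m) + (f ∘ suc ✶ g) m`, so the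
    -- induction runs on `f ∘ suc`.
    (f 0 * g 0 + 0#) * h (suc n) + ((λ m → f 0 * g (suc m) + (f ∘ suc ✶ g) m) ✶ h) n
      ≈⟨ +-cong (trans (*-congʳ (+-identityʳ _)) (*-assoc _ _ _)) (✶-distribʳ h (λ m → f 0 * g (suc m)) (f ∘ suc ✶ g) n) ⟩
    f 0 * (g 0 * h (suc n)) + (((λ m → f 0 * g (suc m)) ✶ h) n + ((f ∘ suc ✶ g) ✶ h) n)
      ≈⟨ +-congˡ (+-cong (scale-✶ (f 0) (g ∘ suc) h n) (✶-assoc (f ∘ suc) g h n)) ⟩
    f 0 * (g 0 * h (suc n)) + (f 0 * (g ∘ suc ✶ h) n + (f ∘ suc ✶ (g ✶ h)) n)
      ≈⟨ +-assoc _ _ _ ⟨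
    f 0 * (g 0 * h (suc n)) + f 0 * (g ∘ suc ✶ h) n + (f ∘ suc ✶ (g ✶ h)) n
      ≈⟨ +-congʳ (distribˡ _ _ _) ⟨
    f 0 * (g 0 * h (suc n) + (g ∘ suc ✶ h) n) + (f ∘ suc ✶ (g ✶ h)) n ∎

  ✶-identityˡ : ∀ f → const rawRing 1# ✶ f ≈ˢ f
  ✶-identityˡ f n = trans (const-✶ 1# f n) (*-identityˡ _)

  -- The operations are those of `powerSeries` themselves, so the underlying raw ring is
  -- definitionally the given one.
  commutativeRing : CommutativeRing c ℓ
  commutativeRing = record
    { RawRing (powerSeries rawRing)
    ; isCommutativeRing = record
      { isRing = record
        { +-isAbelianGroup = record
          { isGroup = record
            { isMonoid = record
              { isSemigroup = record
                { isMagma = record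
                  { isEquivalence = record
                    { refl  = λ _ → refl
                    ; sym   = λ p n → sym (p n)
                    ; trans = λ p q n → trans (p n) (q n)
                    }
                  ; ∙-cong = λ p q n → +-cong (p n) (q n)
                  }
                ; assoc = λ f g h n → +-assoc (f n) (g n) (h n)
                }
              ; identity = (λ f n → +-identityˡ (f n)) , λ f n → +-identityʳ (f n)
              }
            ; inverse = (λ f n → -‿inverseˡ (f n)) , λ f n → -‿inverseʳ (f n)
            ; ⁻¹-cong = λ p n → -‿cong (p n)
            }
          ; comm = λ f g n → +-comm (f n) (g n)
          }
        ; *-cong = ✶-cong
        ; *-assoc = ✶-assoc
        ; *-identity = ✶-identityˡ , λ f n → trans (✶-comm f (const rawRing 1#) n) (✶-identityˡ f n)
        ; distrib =
            (λ f g h n → trans (✶-comm f (λ m → g m + h m) n)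
              (trans (✶-distribʳ f g h n) (+-cong (✶-comm g f n) (✶-comm h f n))))
          , ✶-distribʳ
        }
      ; *-comm = ✶-comm
      }
    }

  var-✶-suc : ∀ f n → (var rawRing ✶ f) (suc n) ≈ f n
  var-✶-suc f n = begin
    0# * f (suc n) + ((var rawRing ∘ suc) ✶ f) n ≈⟨ +-cong (zeroˡ _) (✶-cong {g = f} var∘suc≈1 (λ _ → refl) n) ⟩
    0# + (const rawRing 1# ✶ f) n              ≈⟨ trans (+-identityˡ _) (✶-identityˡ f n) ⟩
    f n                                        ∎
    where
    var∘suc≈1 : var rawRing ∘ suc ≈ˢ const rawRing 1#
    var∘suc≈1 zero    = refl
    var∘suc≈1 (suc n) = refl

  var-✶-0 : ∀ f → (var rawRing ✶ f) 0 ≈ 0#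
  var-✶-0 f = trans (+-identityʳ _) (zeroˡ _)

-- The block series and the coefficients of its powers.

double : ℕ → ℕ
double zero    = zero
double (suc k) = suc (suc (double k))

module _ {c ℓ} (A : CommutativeRing c ℓ) where
  open CommutativeRing A
  open import Algebra.Properties.Semiring.Exp semiring using (_^_)
  open import Algebra.Properties.Semiring.Mult semiring using () renaming (_×_ to _·_)
  open import Relation.Binary.Reasoning.Setoid setoid
  open Solver commutativeSemiring

  -- Expanding G once turns B = z² + 2tz⁴G into B = z² + tz⁴ + tz²B. The factor `F` will be a power
  -- of B, and the outer z² is written as two factors `z` so that each can be removed by an index
  -- shift.
  block-equation : ∀ z t {G} F → G ≈ 1# + t * (z * (z * G)) →
    let B = z ^ 2 + 2 · (z ^ 4 * t) * G in
    B * F ≈ z * (z * (F + (t * (z * (z * F)) + t * (B * F))))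
  block-equation z t {G} F eq = begin
    (z ^ 2 + 2 · (z ^ 4 * t) * G) * F
      ≈⟨ *-congʳ (+-congˡ (*-congˡ eq)) ⟩
    (z ^ 2 + 2 · (z ^ 4 * t) * (1# + t * (z * (z * G)))) * F
      ≈⟨ solve 4 (λ z t G F →
           (z :^ 2 :+ 2 :× (z :^ 4 :* t) :* (con 1 :+ t :* (z :* (z :* G)))) :* F :=
           z :* (z :* (F :+ (t :* (z :* (z :* F)) :+ t :* ((z :^ 2 :+ 2 :× (z :^ 4 :* t) :* G) :* F)))))
           refl z t G F ⟩
    z * (z * (F + (t * (z * (z * F)) + t * ((z ^ 2 + 2 · (z ^ 4 * t) * G) * F)))) ∎

-- The terms of the formula over an arbitrary raw ring: PowerSeries yields
-- a commutative ring whose raw ring equals ℚ⟦u⟧, and the formula is moved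
-- along this equation as a whole.
module _ {c ℓ} (X : RawRing c ℓ) (t : RawRing.Carrier X) where
  private
    module X⟦z⟧ = RawRing (powerSeries X)
  open RawSemiringDefs X⟦z⟧.rawSemiring using (_^_) renaming (_×_ to _·_)

  blockOf : X⟦z⟧.Carrier
  blockOf = var X ^ 2 + 2 · (var X ^ 4 * const X t) * geometric X t
    where open X⟦z⟧

  open RawSemiringDefs (RawRing.rawSemiring X) using () renaming (_×_ to _·ˣ_)

  evenTermOf oddTermOf : ℕ → ℕ → ℤ → RawRing.Carrier X
  evenTermOf p q i = ((p +ₙ q) !) ·ˣ
    hadamard X (fromSeries X (blockOf ^ p)) (fromSeries X (blockOf ^ q)) i
  oddTermOf p q i = ((p +ₙ q) !) ·ˣ
    hadamard X (_*ᴸ_ X (var⁻¹ X) (fromSeries X (blockOf ^ p)))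
               (fromSeries X (var X X⟦z⟧.* (blockOf ^ q))) i

module Block {c ℓ} (R : CommutativeRing c ℓ) (t : CommutativeRing.Carrier R) where
  open CommutativeRing R hiding (zero)
  open import Relation.Binary.Reasoning.Setoid setoid
  private
    module P = CommutativeRing (PowerSeries.commutativeRing R)
  open PowerSeries R
  open RawSemiringDefs (RawRing.rawSemiring (powerSeries rawRing)) using () renaming (_^_ to _^ᴾ_)

  B : P.Carrier
  B = blockOf rawRing t

  private
    Z = var rawRing
    τ = const rawRing t

  geometric-equation : geometric rawRing t P.≈ P.1# P.+ τ P.* (Z P.* (Z P.* geometric rawRing t))
  geometric-equation n = trans (lemma n) (+-congˡ {const rawRing 1# n} (sym (const-✶ t (Z P.* (Z P.* geometric rawRing t)) n)))
    where
    G = geometric rawRing t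
    lemma : ∀ n → G n ≈ const rawRing 1# n + t * (Z P.* (Z P.* G)) n
    lemma zero = sym (trans (+-congˡ (trans (*-congˡ (var-✶-0 (Z P.* G))) (zeroʳ t))) (+-identityʳ 1#))
    lemma (suc zero) = sym (trans (+-identityˡ _)
      (trans (*-congˡ (trans (var-✶-suc (Z P.* G) 0) (var-✶-0 G))) (zeroʳ t)))
    lemma (suc (suc n)) = sym (trans (+-identityˡ _)
      (*-congˡ (trans (var-✶-suc (Z P.* G) (suc n)) (var-✶-suc G n))))

  [_]B^_ : ℕ → ℕ → Carrier
  [ n ]B^ p = (B ^ᴾ p) n

  private
    D : ℕ → P.Carrier
    D p = B ^ᴾ p P.+ (τ P.* (Z P.* (Z P.* B ^ᴾ p)) P.+ τ P.* (B P.* B ^ᴾ p))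

    B^-suc : ∀ p → B ^ᴾ suc p P.≈ Z P.* (Z P.* D p)
    B^-suc p = block-equation (PowerSeries.commutativeRing R) Z τ (B ^ᴾ p) geometric-equation

    D-coeff : ∀ p n → D p n ≈ [ n ]B^ p + (t * (Z P.* (Z P.* B ^ᴾ p)) n + t * [ n ]B^ suc p)
    D-coeff p n = +-congˡ (+-cong (const-✶ t (Z P.* (Z P.* B ^ᴾ p)) n) (const-✶ t (B ^ᴾ suc p) n))

  B^-suc-0 : ∀ p → [ 0 ]B^ suc p ≈ 0#
  B^-suc-0 p = trans (B^-suc p 0) (var-✶-0 (Z P.* D p))

  B^-suc-1 : ∀ p → [ 1 ]B^ suc p ≈ 0#
  B^-suc-1 p = trans (B^-suc p 1) (trans (var-✶-suc (Z P.* D p) 0) (var-✶-0 (D p)))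

  private
    B^-suc-2+ : ∀ p n → [ suc (suc n) ]B^ suc p ≈
      [ n ]B^ p + (t * (Z P.* (Z P.* B ^ᴾ p)) n + t * [ n ]B^ suc p)
    B^-suc-2+ p n = trans (B^-suc p (suc (suc n)))
      (trans (trans (var-✶-suc (Z P.* D p) (suc n)) (var-✶-suc (D p) n)) (D-coeff p n))

    0+[t0+t0]≈0 : ∀ {x y w} → x ≈ 0# → y ≈ 0# → w ≈ 0# → x + (t * y + t * w) ≈ 0#
    0+[t0+t0]≈0 {x} {y} {w} p q r = begin
      x + (t * y + t * w)    ≈⟨ +-cong p (+-cong (trans (*-congˡ q) (zeroʳ t)) (trans (*-congˡ r) (zeroʳ t))) ⟩
      0# + (0# + 0#)         ≈⟨ trans (+-identityˡ _) (+-identityˡ _) ⟩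
      0#                     ∎

  B^-suc-2 : ∀ p → [ 2 ]B^ suc p ≈ [ 0 ]B^ p
  B^-suc-2 p = begin
    [ 2 ]B^ suc p ≈⟨ B^-suc-2+ p 0 ⟩
    [ 0 ]B^ p + (t * (Z P.* (Z P.* B ^ᴾ p)) 0 + t * [ 0 ]B^ suc p)
      ≈⟨ +-congˡ (trans (sym (+-identityˡ _)) (0+[t0+t0]≈0 refl (var-✶-0 (Z P.* B ^ᴾ p)) (B^-suc-0 p))) ⟩
    [ 0 ]B^ p + 0# ≈⟨ +-identityʳ _ ⟩
    [ 0 ]B^ p ∎

  -- The coefficients of B^(p+1) = z²(B^p + tz²B^p + tB^(p+1)). For smaller exponents the terms with
  -- t vanish, which gives the separate initial cases.
  B^-suc-4+ : ∀ p n → [ suc (suc (suc (suc n))) ]B^ suc p ≈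
    [ suc (suc n) ]B^ p + (t * [ n ]B^ p + t * [ suc (suc n) ]B^ suc p)
  B^-suc-4+ p n = trans (B^-suc-2+ p (suc (suc n))) (+-congˡ (+-congʳ (*-congˡ
    (trans (var-✶-suc (Z P.* B ^ᴾ p) (suc n)) (var-✶-suc (B ^ᴾ p) n)))))

  private
    B^-suc-3 : ∀ p → [ 3 ]B^ suc p ≈ [ 1 ]B^ p
    B^-suc-3 p = begin
      [ 3 ]B^ suc p ≈⟨ B^-suc-2+ p 1 ⟩
      [ 1 ]B^ p + (t * (Z P.* (Z P.* B ^ᴾ p)) 1 + t * [ 1 ]B^ suc p)
        ≈⟨ +-congˡ (trans (sym (+-identityˡ _)) (0+[t0+t0]≈0 refl
             (trans (var-✶-suc (Z P.* B ^ᴾ p) 0) (var-✶-0 (B ^ᴾ p))) (B^-suc-1 p))) ⟩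
      [ 1 ]B^ p + 0# ≈⟨ +-identityʳ _ ⟩
      [ 1 ]B^ p ∎

  -- `B` is a series in z²; the recurrence preserves the parity of the exponent.
  B^-odd : ∀ p k → [ suc (double k) ]B^ p ≈ 0#
  B^-odd zero    k             = refl
  B^-odd (suc p) zero          = B^-suc-1 p
  B^-odd (suc p) (suc zero)    = trans (B^-suc-3 p) (B^-odd p 0)
  B^-odd (suc p) (suc (suc k)) = trans (B^-suc-4+ p (suc (double k)))
    (0+[t0+t0]≈0 (B^-odd p (suc k)) (B^-odd p k) (B^-odd (suc p) (suc k)))

  -- Each factor `B` is divisible by z². The bound p in place of 2p is enough to make the double
  -- sums finite.
  B^-vanish : ∀ {p n} → n < p → [ n ]B^ p ≈ 0#
  B^-vanish {suc p} {zero}  _ = B^-suc-0 p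
  B^-vanish {suc p} {suc zero} _ = B^-suc-1 p
  B^-vanish {suc p} {suc (suc zero)} (s≤s n<p) = trans (B^-suc-2 p) (B^-vanish (ℕₚ.<-trans (s≤s z≤n) n<p))
  B^-vanish {suc p} {suc (suc (suc zero))} (s≤s n<p) = trans (B^-suc-3 p) (B^-vanish (ℕₚ.<-trans (s≤s (s≤s z≤n)) n<p))
  B^-vanish {suc p} {suc (suc (suc (suc n)))} (s≤s n<p) = trans (B^-suc-4+ p n)
    (0+[t0+t0]≈0 (B^-vanish (ℕₚ.<-trans (ℕₚ.n<1+n _) n<p))
                 (B^-vanish (ℕₚ.<-trans (ℕₚ.n<1+n _) (ℕₚ.<-trans (ℕₚ.n<1+n _) (ℕₚ.<-trans (ℕₚ.n<1+n _) n<p))))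
                 (B^-vanish (ℕₚ.<-trans (ℕₚ.<-trans (ℕₚ.n<1+n _) n<p) (ℕₚ.n<1+n p))))

-- Weighted sums over marks as linear functionals.

module Functionals {c ℓ} (R : CommutativeRing c ℓ) (t : CommutativeRing.Carrier R) where
  open CommutativeRing R hiding (zero)
  open import Relation.Binary.Reasoning.Setoid setoid
  open import Algebra.Properties.CommutativeSemigroup +-commutativeSemigroup using (interchange)
  open import Algebra.Properties.Semiring.Mult semiring using (×1-homo-*; ×-congʳ; ×-assoc-*) renaming (_×_ to _·_)
  open import Algebra.Properties.Semiring.Exp semiring using (_^_)
  open import Algebra.Properties.Semiring.Sum semiring using (sum; sum-cong-≋; sum-replicate-zero; ∑-distrib-+; *-distribˡ-sum)
  open Solver commutativeSemiring
  open Block R t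

  joins# : ℕ → Bool → Carrier
  joins# k b = joins k b · 1#

  -- L k b ψ is the sum of t^|M| 2^r ψ(m) over all sets M of marked edges
  -- of a path of k vertices, where M has m blocks, r of them nontrivial,
  -- and b tells whether the first edge is marked.
  L : ℕ → Bool → (ℕ → Carrier) → Carrier
  L zero    false ψ = ψ 0
  L zero    true  ψ = 0#
  L (suc k) false ψ = L k false (ψ ∘ suc) + L k true (ψ ∘ suc)
  L (suc k) true  ψ = t * (joins# k false * L k false ψ + joins# k true * L k true ψ)

  record Linear (Λ : (ℕ → Carrier) → Carrier) : Set (c ⊔ ℓ) where
    field
      cong   : ∀ {ψ ψ′} → (∀ n → ψ n ≈ ψ′ n) → Λ ψ ≈ Λ ψ′
      homo-+ : ∀ ψ ψ′ → Λ (λ n → ψ n + ψ′ n) ≈ Λ ψ + Λ ψ′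
      homo-* : ∀ a ψ → Λ (λ n → a * ψ n) ≈ a * Λ ψ

    homo-0 : Λ (λ _ → 0#) ≈ 0#
    homo-0 = trans (cong λ _ → sym (zeroˡ 0#)) (trans (homo-* 0# (λ _ → 0#)) (zeroˡ _))

  open Linear

  L-linear : ∀ k b → Linear (L k b)
  cong   (L-linear zero    false) e = e 0
  cong   (L-linear zero    true)  e = refl
  cong   (L-linear (suc k) false) e =
    +-cong (cong (L-linear k false) (e ∘ suc)) (cong (L-linear k true) (e ∘ suc))
  cong   (L-linear (suc k) true)  e =
    *-congˡ (+-cong (*-congˡ (cong (L-linear k false) e)) (*-congˡ (cong (L-linear k true) e)))
  homo-+ (L-linear zero    false) ψ ψ′ = refl
  homo-+ (L-linear zero    true)  ψ ψ′ = sym (+-identityˡ 0#)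
  homo-+ (L-linear (suc k) false) ψ ψ′ =
    trans (+-cong (homo-+ (L-linear k false) _ _) (homo-+ (L-linear k true) _ _)) (interchange _ _ _ _)
  homo-+ (L-linear (suc k) true)  ψ ψ′ =
    trans (*-congˡ (+-cong (*-congˡ (homo-+ (L-linear k false) ψ ψ′)) (*-congˡ (homo-+ (L-linear k true) ψ ψ′))))
      (solve 7 (λ t j j′ x y x′ y′ → t :* (j :* (x :+ y) :+ j′ :* (x′ :+ y′)) :=
                 t :* (j :* x :+ j′ :* x′) :+ t :* (j :* y :+ j′ :* y′)) refl _ _ _ _ _ _ _)
  homo-* (L-linear zero    false) a ψ = refl
  homo-* (L-linear zero    true)  a ψ = sym (zeroʳ a)
  homo-* (L-linear (suc k) false) a ψ =
    trans (+-cong (homo-* (L-linear k false) a _) (homo-* (L-linear k true) a _)) (sym (distribˡ _ _ _))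
  homo-* (L-linear (suc k) true)  a ψ =
    trans (*-congˡ (+-cong (*-congˡ (homo-* (L-linear k false) a ψ)) (*-congˡ (homo-* (L-linear k true) a ψ))))
      (solve 6 (λ t j j′ a x y → t :* (j :* (a :* x) :+ j′ :* (a :* y)) :=
                 a :* (t :* (j :* x :+ j′ :* y))) refl _ _ _ _ _ _)

  -- `L k b` is built from evaluations by sums and scalar multiples, all of which a linear `Λ`
  -- respects. This is the interchange of the sums over the marks of the two paths.
  L-swap : ∀ {Λ} → Linear Λ → ∀ k b (F : ℕ → ℕ → Carrier) →
           L k b (λ p → Λ (F p)) ≈ Λ (λ q → L k b (λ p → F p q))
  L-swap Λ-lin zero    false F = refl
  L-swap Λ-lin zero    true  F = sym (homo-0 Λ-lin)
  L-swap Λ-lin (suc k) false F = trans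
    (+-cong (L-swap Λ-lin k false (F ∘ suc)) (L-swap Λ-lin k true (F ∘ suc)))
    (sym (homo-+ Λ-lin _ _))
  L-swap {Λ} Λ-lin (suc k) true  F = sym (begin
    Λ (λ q → t * (joins# k false * L k false (λ p → F p q) + joins# k true * L k true (λ p → F p q)))
      ≈⟨ trans (homo-* Λ-lin t _) (*-congˡ (homo-+ Λ-lin _ _)) ⟩
    t * (Λ (λ q → joins# k false * L k false (λ p → F p q)) + Λ (λ q → joins# k true * L k true (λ p → F p q)))
      ≈⟨ *-congˡ (+-cong (step false) (step true)) ⟩
    t * (joins# k false * L k false (λ p → Λ (F p)) + joins# k true * L k true (λ p → Λ (F p))) ∎)
    where
    step : ∀ b → Λ (λ q → joins# k b * L k b (λ p → F p q)) ≈ joins# k b * L k b (λ p → Λ (F p))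
    step b = trans (homo-* Λ-lin (joins# k b) _) (*-congˡ (sym (L-swap Λ-lin k b F)))

  -- Among n positions, the path through the first one has `⌈ n /2⌉` vertices and the other
  -- `⌊ n /2⌋`. The paths interact only through the total number p + q of blocks.
  L² : ℕ → Bool → Bool → (ℕ → Carrier) → Carrier
  L² n b b′ φ = L ⌈ n /2⌉ b (λ p → L ⌊ n /2⌋ b′ (λ q → φ (p +ₙ q)))

  L-swap-+ : ∀ k b k′ b′ φ → L k b (λ p → L k′ b′ (λ q → φ (p +ₙ q))) ≈
                              L k′ b′ (λ p → L k b (λ q → φ (p +ₙ q)))
  L-swap-+ k b k′ b′ φ = trans (L-swap (L-linear k′ b′) k b (λ p q → φ (p +ₙ q)))
    (cong (L-linear k′ b′) λ p → cong (L-linear k b) λ q → reflexive (≡.cong φ (ℕₚ.+-comm q p)))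

  -- A new first position extends the path with `⌊ n /2⌋` vertices, which thereby becomes the first
  -- path; exchanging the two functionals restores the order.
  L²-suc-false : ∀ n b φ → L² (suc n) false b φ ≈ L² n b false (φ ∘ suc) + L² n b true (φ ∘ suc)
  L²-suc-false n b φ = +-cong
    (L-swap-+ ⌊ n /2⌋ false ⌈ n /2⌉ b (φ ∘ suc)) (L-swap-+ ⌊ n /2⌋ true ⌈ n /2⌉ b (φ ∘ suc))

  L²-suc-true : ∀ n b φ → L² (suc n) true b φ ≈
    t * (joins# ⌊ n /2⌋ false * L² n b false φ + joins# ⌊ n /2⌋ true * L² n b true φ)
  L²-suc-true n b φ = *-congˡ (+-cong
    (*-congˡ (L-swap-+ ⌊ n /2⌋ false ⌈ n /2⌉ b φ)) (*-congˡ (L-swap-+ ⌊ n /2⌋ true ⌈ n /2⌉ b φ)))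

  ∑ᴹ : ∀ n → (Vec Bool n → Carrier) → Carrier
  ∑ᴹ zero    f = f []
  ∑ᴹ (suc n) f = ∑ᴹ n (f ∘ (false ∷_)) + ∑ᴹ n (f ∘ (true ∷_))

  ∑ᴹ-cong : ∀ n {f g : Vec Bool n → Carrier} → (∀ M → f M ≈ g M) → ∑ᴹ n f ≈ ∑ᴹ n g
  ∑ᴹ-cong zero    e = e []
  ∑ᴹ-cong (suc n) e = +-cong (∑ᴹ-cong n (e ∘ (false ∷_))) (∑ᴹ-cong n (e ∘ (true ∷_)))

  weight : ∀ {n} → Vec Bool n → Carrier
  weight M = orientations M · t ^ #true M

  weight-true : ∀ {n} (M : Vec Bool n) → weight (true ∷ M) ≈ t * joins# ⌊ n /2⌋ (second M) * weight M
  weight-true {n} M = begin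
    (j *ₙ o) · (t * x)          ≈⟨ trans (×-assoc-* (j *ₙ o) 1# (t * x)) (×-congʳ (j *ₙ o) (*-identityˡ (t * x))) ⟨
    (j *ₙ o) · 1# * (t * x)     ≈⟨ *-congʳ (×1-homo-* j o) ⟩
    j · 1# * (o · 1#) * (t * x) ≈⟨ solve 4 (λ j o t x → j :* o :* (t :* x) := t :* j :* (o :* x)) refl _ _ _ _ ⟩
    t * (j · 1#) * (o · 1# * x) ≈⟨ *-congˡ (trans (×-assoc-* o 1# x) (×-congʳ o (*-identityˡ x))) ⟩
    t * (j · 1#) * (o · x)      ∎
    where
    j = joins ⌊ n /2⌋ (second M)
    o = orientations M
    x = t ^ #true M

  -- The first two places are the first edges of the two paths; adding a
  -- position in front exchanges the roles of the paths.
  ∑ᴹ-weight : ∀ n (γ : Bool → Bool → Carrier) φ →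
    ∑ᴹ n (λ M → γ (first M) (second M) * (weight M * φ (#false M))) ≈
    (γ false false * L² n false false φ + γ false true * L² n false true φ) +
    (γ true false * L² n true false φ + γ true true * L² n true true φ)
  ∑ᴹ-weight zero γ φ = solve 5 (λ a b c d x →
    a :* ((con 1 :+ con 0) :* x) := (a :* x :+ b :* con 0) :+ (c :* con 0 :+ d :* con 0)) refl _ _ _ _ _
  ∑ᴹ-weight (suc n) γ φ = +-cong
    (begin
      ∑ᴹ n (λ M → γ false (first M) * (weight M * φ (suc (#false M))))
        ≈⟨ ∑ᴹ-weight n (λ b _ → γ false b) (φ ∘ suc) ⟩
      _ ≈⟨ +-cong (distribˡ _ _ _) (distribˡ _ _ _) ⟨
      _ ≈⟨ +-cong (*-congˡ (L²-suc-false n false φ)) (*-congˡ (L²-suc-false n true φ)) ⟨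
      γ false false * L² (suc n) false false φ + γ false true * L² (suc n) false true φ ∎)
    (begin
      ∑ᴹ n (λ M → γ true (first M) * (weight (true ∷ M) * φ (#false M)))
        ≈⟨ ∑ᴹ-cong n (λ M → trans (*-congˡ (*-congʳ (weight-true M)))
             (solve 5 (λ g t j w x → g :* (t :* j :* w :* x) := g :* (t :* j) :* (w :* x)) refl _ _ _ _ _)) ⟩
      ∑ᴹ n (λ M → γ true (first M) * (t * joins# ⌊ n /2⌋ (second M)) * (weight M * φ (#false M)))
        -- The factor from `weight-true` depends on the second mark of `M`; the freedom in `γ`
        -- absorbs it.
        ≈⟨ ∑ᴹ-weight n (λ b b′ → γ true b * (t * joins# ⌊ n /2⌋ b′)) φ ⟩
      _ ≈⟨ +-cong (collect _ _ _ _ _) (collect _ _ _ _ _) ⟩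
      _ ≈⟨ +-cong (*-congˡ (L²-suc-true n false φ)) (*-congˡ (L²-suc-true n true φ)) ⟨
      γ true false * L² (suc n) true false φ + γ true true * L² (suc n) true true φ ∎)
    where
    collect : ∀ g j j′ x y → g * (t * j) * x + g * (t * j′) * y ≈ g * (t * (j * x + j′ * y))
    collect g j j′ x y = solve 6 (λ t g j j′ x y →
      g :* (t :* j) :* x :+ g :* (t :* j′) :* y := g :* (t :* (j :* x :+ j′ :* y))) refl t g j j′ x y

  T : ℕ → (ℕ → Carrier) → Carrier
  T k ψ = L k false ψ + L k true ψ

  ∑ᴹ-weight-T : ∀ n φ → ∑ᴹ n (λ M → weight M * φ (#false M)) ≈
                         T ⌈ n /2⌉ (λ p → T ⌊ n /2⌋ (λ q → φ (p +ₙ q)))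
  ∑ᴹ-weight-T n φ = begin
    ∑ᴹ n (λ M → weight M * φ (#false M)) ≈⟨ ∑ᴹ-cong n (λ M → *-identityˡ _) ⟨
    _ ≈⟨ ∑ᴹ-weight n (λ _ _ → 1#) φ ⟩
    _ ≈⟨ +-cong (+-cong (*-identityˡ _) (*-identityˡ _)) (+-cong (*-identityˡ _) (*-identityˡ _)) ⟩
    _ ≈⟨ +-cong (homo-+ (L-linear ⌈ n /2⌉ false) _ _) (homo-+ (L-linear ⌈ n /2⌉ true) _ _) ⟨
    T ⌈ n /2⌉ (λ p → T ⌊ n /2⌋ (λ q → φ (p +ₙ q))) ∎

  -- The coefficients of z^(2k) in the powers of `B` represent the functional `T k`, since both
  -- sides satisfy the same recurrence. As B^p starts at z^(2p), the exponents p up to k exhaust the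
  -- sum. For positive k the term p = 0 vanishes, which leaves the sum in `∑-B^-tail`.
  ∑-B^ : ∀ k {N} → k < N → ∀ ψ → sum {N} (λ p → [ double k ]B^ toℕ p * ψ (toℕ p)) ≈ T k ψ
  ∑-B^-tail : ∀ k {N} → suc k < suc N → ∀ ψ →
    sum {N} (λ p → [ double (suc k) ]B^ suc (toℕ p) * ψ (suc (toℕ p))) ≈ T (suc k) ψ
  ∑-B^ zero {suc N} _ ψ = +-cong (*-identityˡ _)
    (trans (sum-cong-≋ λ (p : Fin N) → trans (*-congʳ (B^-suc-0 (toℕ p))) (zeroˡ _)) (sum-replicate-zero N))
  ∑-B^ (suc k) {suc N} k<N ψ = trans (+-cong (zeroˡ _) (∑-B^-tail k k<N ψ)) (+-identityˡ _)
  ∑-B^-tail zero {N} (s≤s 0<N) ψ = begin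
    sum {N} (λ p → [ 2 ]B^ suc (toℕ p) * ψ (suc (toℕ p)))
      ≈⟨ sum-cong-≋ (λ (p : Fin N) → *-congʳ (B^-suc-2 (toℕ p))) ⟩
    sum {N} (λ p → [ 0 ]B^ toℕ p * ψ (suc (toℕ p)))
      ≈⟨ ∑-B^ zero 0<N (ψ ∘ suc) ⟩
    T 0 (ψ ∘ suc)
      -- A single vertex has no edge to mark: `joins` is 0 on an empty rest of the path.
      ≈⟨ solve 3 (λ t x y → x :+ con 0 := (x :+ con 0) :+ t :* (con 0 :* y :+ con 0 :* con 0)) refl t (ψ 1) (ψ 0) ⟩
    T 1 ψ ∎
  ∑-B^-tail (suc k) {N} (s≤s k<N) ψ = begin
    sum {N} (λ p → [ double (suc (suc k)) ]B^ suc (toℕ p) * ψ (suc (toℕ p)))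
      ≈⟨ sum-cong-≋ (λ (p : Fin N) → trans (*-congʳ (B^-suc-4+ (toℕ p) (double k)))
           (solve 5 (λ a t b d x → (a :+ (t :* b :+ t :* d)) :* x := a :* x :+ t :* (b :* x :+ d :* x)) refl _ _ _ _ _)) ⟩
    sum {N} (λ p → a p + t * (b p + d p))
      ≈⟨ trans (∑-distrib-+ a _) (+-congˡ (trans (sym (*-distribˡ-sum t (λ p → b p + d p))) (*-congˡ (∑-distrib-+ b d)))) ⟩
    sum a + t * (sum b + sum d)
      ≈⟨ +-cong (∑-B^ (suc k) k<N (ψ ∘ suc)) (*-congˡ (+-cong
           (∑-B^ k (ℕₚ.<-trans (ℕₚ.n<1+n k) k<N) (ψ ∘ suc))
           (∑-B^-tail k (ℕₚ.<-trans k<N (ℕₚ.n<1+n N)) ψ))) ⟩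
    T (suc k) (ψ ∘ suc) + t * (T k (ψ ∘ suc) + T (suc k) ψ)
      -- `T k (ψ ∘ suc)` is `L (suc k) false ψ`. Its second occurrence, inside `T (suc k) ψ`,
      -- completes the weight 2 of joining to an unmarked vertex; a marked one has weight 1.
      ≈⟨ solve 4 (λ t a x y → a :+ t :* (x :+ (x :+ y)) :=
                    a :+ t :* ((con 1 :+ (con 1 :+ con 0)) :* x :+ (con 1 :+ con 0) :* y)) refl t _ _ _ ⟩
    T (suc (suc k)) ψ ∎
    where
    a b d : Fin N → Carrier
    a p = [ double (suc k) ]B^ toℕ p * ψ (suc (toℕ p))
    b p = [ double k ]B^ toℕ p * ψ (suc (toℕ p))
    d p = [ double (suc k) ]B^ suc (toℕ p) * ψ (suc (toℕ p))

-- Expansion of the separator statistic over marks.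

module Expansion {c ℓ} (R : CommutativeRing c ℓ) (t : CommutativeRing.Carrier R) where
  open CommutativeRing R hiding (zero)
  open import Relation.Binary.Reasoning.Setoid setoid
  open import Algebra.Properties.CommutativeSemigroup +-commutativeSemigroup using (interchange)
  open import Algebra.Properties.Semiring.Mult semiring using (×1-homo-*; ×-congʳ; ×-congˡ; ×-homo-+; ×-homo-1; ×-assocˡ; ×-assoc-*; ×-comm-*) renaming (_×_ to _·_)
  open import Algebra.Properties.Semiring.Exp semiring using (_^_; ^-homo-*)
  open import Algebra.Properties.Semiring.Sum semiring using (sum; sum-cong-≋; sum-replicate-zero; ∑-distrib-+; *-distribˡ-sum)
  open Solver commutativeSemiring
  open Functionals R t
  open Block R t

  private
    variable
      A B′ C : Set

  ∑ₗ : List A → (A → Carrier) → Carrier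
  ∑ₗ xs f = foldr (λ x → f x +_) 0# xs

  ∑ₗ-cong : ∀ {P : A → Set} {xs} → All P xs → ∀ {f g : A → Carrier} → (∀ {x} → P x → f x ≈ g x) → ∑ₗ xs f ≈ ∑ₗ xs g
  ∑ₗ-cong []       e = refl
  ∑ₗ-cong (p ∷ ps) e = +-cong (e p) (∑ₗ-cong ps e)

  ∑ₗ-cong′ : ∀ (xs : List A) {f g : A → Carrier} → (∀ x → f x ≈ g x) → ∑ₗ xs f ≈ ∑ₗ xs g
  ∑ₗ-cong′ []       e = refl
  ∑ₗ-cong′ (x ∷ xs) e = +-cong (e x) (∑ₗ-cong′ xs e)

  ∑ₗ-zero : ∀ (xs : List A) → ∑ₗ xs (λ _ → 0#) ≈ 0#
  ∑ₗ-zero []       = refl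
  ∑ₗ-zero (x ∷ xs) = trans (+-identityˡ _) (∑ₗ-zero xs)

  ∑ₗ-+ : ∀ (xs : List A) (f g : A → Carrier) → ∑ₗ xs (λ x → f x + g x) ≈ ∑ₗ xs f + ∑ₗ xs g
  ∑ₗ-+ []       f g = sym (+-identityˡ 0#)
  ∑ₗ-+ (x ∷ xs) f g = trans (+-congˡ (∑ₗ-+ xs f g)) (interchange _ _ _ _)

  ∑ₗ-++ : ∀ (xs ys : List A) (f : A → Carrier) → ∑ₗ (xs ++ ys) f ≈ ∑ₗ xs f + ∑ₗ ys f
  ∑ₗ-++ []       ys f = sym (+-identityˡ _)
  ∑ₗ-++ (x ∷ xs) ys f = trans (+-congˡ (∑ₗ-++ xs ys f)) (sym (+-assoc _ _ _))

  ∑ₗ-map : ∀ (g : A → B′) xs (f : B′ → Carrier) → ∑ₗ (List.map g xs) f ≡ ∑ₗ xs (f ∘ g)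
  ∑ₗ-map g []       f = ≡.refl
  ∑ₗ-map g (x ∷ xs) f = ≡.cong (f (g x) +_) (∑ₗ-map g xs f)

  ∑ₗ-cartesianProductWith : ∀ (g : A → B′ → C) xs ys (f : C → Carrier) →
    ∑ₗ (cartesianProductWith g xs ys) f ≈ ∑ₗ ys (λ y → ∑ₗ xs (λ x → f (g x y)))
  ∑ₗ-cartesianProductWith g []       ys f = sym (∑ₗ-zero ys)
  ∑ₗ-cartesianProductWith g (x ∷ xs) ys f = begin
    ∑ₗ (List.map (g x) ys ++ cartesianProductWith g xs ys) f
      ≈⟨ ∑ₗ-++ (List.map (g x) ys) _ f ⟩
    ∑ₗ (List.map (g x) ys) f + ∑ₗ (cartesianProductWith g xs ys) f
      ≈⟨ +-cong (reflexive (∑ₗ-map (g x) ys f)) (∑ₗ-cartesianProductWith g xs ys f) ⟩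
    ∑ₗ ys (f ∘ g x) + ∑ₗ ys (λ y → ∑ₗ xs (λ x → f (g x y)))
      ≈⟨ ∑ₗ-+ ys _ _ ⟨
    ∑ₗ ys (λ y → f (g x y) + ∑ₗ xs (λ x → f (g x y))) ∎

  ∑ₗ-tabulate-· : ∀ n (g : Fin n → A) (c : A → ℕ) x → ∑ₗ (tabulate g) (λ d → c d · x) ≈ ℕΣ.sum (c ∘ g) · x
  ∑ₗ-tabulate-· zero    g c x = refl
  ∑ₗ-tabulate-· (suc n) g c x = trans (+-congˡ (∑ₗ-tabulate-· n (g ∘ suc) c x)) (sym (×-homo-+ x (c (g zero)) _))

  -- The sum over the first digit multiplies every summand by `extensions b M`, whatever the rest of
  -- the permutation. The arbitrary `x` takes up this factor in the induction.
  ∑-χ : ∀ {n} (M : Vec Bool n) x → ∑ₗ (S n) (λ w → χ M w · x) ≈ placements M · x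
  ∑-χ []              x = +-identityʳ _
  ∑-χ {suc n} (b ∷ M) x = begin
    ∑ₗ (S (suc n)) (λ w → χ (b ∷ M) w · x)
      ≡⟨ ≡.cong (λ ws → ∑ₗ ws (λ w → χ (b ∷ M) w · x)) (S-suc n) ⟩
    ∑ₗ (cartesianProductWith insertFirst (allFin (suc n)) (S n)) (λ w → χ (b ∷ M) w · x)
      ≈⟨ ∑ₗ-cartesianProductWith insertFirst (allFin (suc n)) (S n) _ ⟩
    ∑ₗ (S n) (λ w → ∑ₗ (allFin (suc n)) (λ d → χ (b ∷ M) (insertFirst d w) · x))
      ≈⟨ ∑ₗ-cong (S-Inj n) (λ {w} → step {w}) ⟩
    ∑ₗ (S n) (λ w → χ M w · (extensions b M · x)) ≈⟨ ∑-χ M (extensions b M · x) ⟩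
    placements M · (extensions b M · x)    ≈⟨ ×-assocˡ x (placements M) (extensions b M) ⟩
    (placements M *ₙ extensions b M) · x   ≡⟨ ≡.cong (_· x) (placements-∷ b M) ⟨
    placements (b ∷ M) · x ∎
    where
    step : ∀ {w} → Inj w → ∑ₗ (allFin (suc n)) (λ d → χ (b ∷ M) (insertFirst d w) · x) ≈ χ M w · (extensions b M · x)
    step {w} inj = begin
      ∑ₗ (allFin (suc n)) (λ d → χ (b ∷ M) (insertFirst d w) · x)
        ≈⟨ ∑ₗ-tabulate-· (suc n) id (λ d → χ (b ∷ M) (insertFirst d w)) x ⟩
      ℕΣ.sum (λ d → χ (b ∷ M) (insertFirst d w)) · x
        ≡⟨ ≡.cong (_· x) (≡.trans (χ-sum b M w inj) (ℕₚ.*-comm (extensions b M) (χ M w))) ⟩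
      (χ M w *ₙ extensions b M) · x ≈⟨ ×-assocˡ x (χ M w) (extensions b M) ⟨
      χ M w · (extensions b M · x) ∎

  ∑ᴹ-* : ∀ n a (f : Vec Bool n → Carrier) → ∑ᴹ n (λ M → a * f M) ≈ a * ∑ᴹ n f
  ∑ᴹ-* zero    a f = refl
  ∑ᴹ-* (suc n) a f = trans (+-cong (∑ᴹ-* n a _) (∑ᴹ-* n a _)) (sym (distribˡ a _ _))

  ∑ₗ-∑ᴹ : ∀ n (xs : List A) (f : A → Vec Bool n → Carrier) →
    ∑ₗ xs (λ x → ∑ᴹ n (f x)) ≈ ∑ᴹ n (λ M → ∑ₗ xs (λ x → f x M))
  ∑ₗ-∑ᴹ zero    xs f = refl
  ∑ₗ-∑ᴹ (suc n) xs f = trans (∑ₗ-+ xs _ _) (+-cong (∑ₗ-∑ᴹ n xs _) (∑ₗ-∑ᴹ n xs _))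

  1+t^lead : ∀ {n k} (x : Fin n) (w : Vec (Fin n) k) → (1# + t) ^ lead x w ≈ 1# + lead x w · t
  1+t^lead x w with lead x w | lead-0-1 x w
  ... | _ | inj₁ ≡.refl = sym (+-identityʳ 1#)
  ... | _ | inj₂ ≡.refl = trans (*-identityʳ _) (+-congˡ (sym (×-homo-1 t)))

  -- As `lead` is 0 or 1, each position contributes 1 + `lead` t; choosing the second term means
  -- marking the position.
  1+t^leads : ∀ {n k} (w : Vec (Fin n) k) → (1# + t) ^ leads w ≈ ∑ᴹ k (λ M → χ M w · t ^ #true M)
  1+t^leads []      = sym (×-homo-1 1#)
  1+t^leads {k = suc k} (x ∷ w) = begin
    (1# + t) ^ (lead x w +ₙ leads w)       ≈⟨ ^-homo-* (1# + t) (lead x w) (leads w) ⟩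
    (1# + t) ^ lead x w * (1# + t) ^ leads w ≈⟨ *-cong (1+t^lead x w) (1+t^leads w) ⟩
    (1# + lead x w · t) * ∑ᴹ k E           ≈⟨ trans (distribʳ _ _ _) (+-congʳ (*-identityˡ _)) ⟩
    ∑ᴹ k E + (lead x w · t) * ∑ᴹ k E
      ≈⟨ +-cong (∑ᴹ-cong k λ M → ×-congˡ {t ^ #true M} (≡.sym (ℕₚ.*-identityˡ (χ M w))))
                (trans (sym (∑ᴹ-* k (lead x w · t) E)) (∑ᴹ-cong k λ M → marked (lead x w) (χ M w) (t ^ #true M))) ⟩
    ∑ᴹ (suc k) (λ M → χ M (x ∷ w) · t ^ #true M) ∎
    where
    E : Vec Bool k → Carrier
    E M = χ M w · t ^ #true M
    marked : ∀ l c y → (l · t) * (c · y) ≈ (l *ₙ c) · (t * y)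
    marked l c y = begin
      (l · t) * (c · y)    ≈⟨ ×-assoc-* l t (c · y) ⟩
      l · (t * (c · y))    ≈⟨ ×-congʳ l (×-comm-* c t y) ⟩
      l · (c · (t * y))    ≈⟨ ×-assocˡ (t * y) l c ⟩
      (l *ₙ c) · (t * y)   ∎

  ∑-1+t^leads : ∀ n → ∑ₗ (S n) (λ w → (1# + t) ^ leads w) ≈
    T ⌈ n /2⌉ (λ p → T ⌊ n /2⌋ (λ q → ((p +ₙ q) !) · 1#))
  ∑-1+t^leads n = begin
    ∑ₗ (S n) (λ w → (1# + t) ^ leads w)
      ≈⟨ ∑ₗ-cong′ (S n) 1+t^leads ⟩
    ∑ₗ (S n) (λ w → ∑ᴹ n (λ M → χ M w · t ^ #true M))
      ≈⟨ ∑ₗ-∑ᴹ n (S n) (λ w M → χ M w · t ^ #true M) ⟩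
    ∑ᴹ n (λ M → ∑ₗ (S n) (λ w → χ M w · t ^ #true M))
      ≈⟨ ∑ᴹ-cong n (λ M → trans (∑-χ M (t ^ #true M)) (regroup ((#false M) !) (orientations M) (t ^ #true M))) ⟩
    ∑ᴹ n (λ M → weight M * (((#false M) !) · 1#))
      ≈⟨ ∑ᴹ-weight-T n (λ m → (m !) · 1#) ⟩
    T ⌈ n /2⌉ (λ p → T ⌊ n /2⌋ (λ q → ((p +ₙ q) !) · 1#)) ∎
    where
    regroup : ∀ f o y → (f *ₙ o) · y ≈ (o · y) * (f · 1#)
    regroup f o y = begin
      (f *ₙ o) · y        ≈⟨ ×-assocˡ y f o ⟨
      f · (o · y)         ≈⟨ ×-congʳ f (*-identityʳ _) ⟨
      f · (o · y * 1#)    ≈⟨ ×-comm-* f (o · y) 1# ⟨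
      (o · y) * (f · 1#)  ∎

  ∑∑-B^ : ∀ k k′ {N} → k < N → k′ < N →
    sum {N} (λ p → sum {N} (λ q → ((toℕ p +ₙ toℕ q) !) · ([ double k ]B^ toℕ p * [ double k′ ]B^ toℕ q))) ≈
    T k (λ p → T k′ (λ q → ((p +ₙ q) !) · 1#))
  ∑∑-B^ k k′ {N} k<N k′<N = begin
    _ ≈⟨ sum-cong-≋ {N} (λ p → trans (sum-cong-≋ {N} λ q → regroup ((toℕ p +ₙ toℕ q) !) _ _)
           (sym (*-distribˡ-sum {N} ([ double k ]B^ toℕ p) (λ q → [ double k′ ]B^ toℕ q * (((toℕ p +ₙ toℕ q) !) · 1#))))) ⟩
    sum {N} (λ p → [ double k ]B^ toℕ p * sum {N} (λ q → [ double k′ ]B^ toℕ q * (((toℕ p +ₙ toℕ q) !) · 1#)))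
      ≈⟨ sum-cong-≋ {N} (λ p → *-congˡ (∑-B^ k′ k′<N (λ q → ((toℕ p +ₙ q) !) · 1#))) ⟩
    sum {N} (λ p → [ double k ]B^ toℕ p * T k′ (λ q → ((toℕ p +ₙ q) !) · 1#))
      ≈⟨ ∑-B^ k k<N (λ p → T k′ (λ q → ((p +ₙ q) !) · 1#)) ⟩
    T k (λ p → T k′ (λ q → ((p +ₙ q) !) · 1#)) ∎
    where
    regroup : ∀ f x y → f · (x * y) ≈ x * (y * (f · 1#))
    regroup f x y = begin
      f · (x * y)          ≈⟨ ×-congʳ f (*-congˡ (*-identityʳ y)) ⟨
      f · (x * (y * 1#))   ≈⟨ ×-comm-* f x (y * 1#) ⟨
      x * (f · (y * 1#))   ≈⟨ *-congˡ (×-comm-* f y 1#) ⟨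
      x * (y * (f · 1#))   ∎

  sum-δ : ∀ {N} a → a < N → ∀ (f : ℕ → Carrier) → sum {N} (λ m → δ a (toℕ m) · f (toℕ m)) ≈ f a
  sum-δ {suc N} zero    _         f = trans (+-cong (×-homo-1 _) (sum-replicate-zero N)) (+-identityʳ _)
  sum-δ {suc N} (suc a) (s≤s a<N) f = trans (+-identityˡ _) (sum-δ a a<N (f ∘ suc))

  -- Each `x` is counted in one fibre only, the one over `st x`, and the bound places that fibre
  -- within the range of summation.
  ∑-fibres : ∀ {A : Set} (st : A → ℕ) u N xs → All (λ x → st x < N) xs →
    sum {N} (λ m → length (filter (λ x → st x ℕₚ.≟ toℕ m) xs) · u ^ toℕ m) ≈ ∑ₗ xs (λ x → u ^ st x)
  ∑-fibres st u N []       []         = sum-replicate-zero N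
  ∑-fibres st u N (x ∷ xs) (x<N ∷ ps) = begin
    sum {N} (λ m → length (filter (λ y → st y ℕₚ.≟ toℕ m) (x ∷ xs)) · u ^ toℕ m)
      ≈⟨ sum-cong-≋ {N} (λ m → trans (×-congˡ {u ^ toℕ m} (length-filter-∷ (toℕ m)))
           (×-homo-+ (u ^ toℕ m) (δ (st x) (toℕ m)) _)) ⟩
    sum {N} (λ m → δ (st x) (toℕ m) · u ^ toℕ m + length (filter (λ y → st y ℕₚ.≟ toℕ m) xs) · u ^ toℕ m)
      ≈⟨ ∑-distrib-+ {N} (λ m → δ (st x) (toℕ m) · u ^ toℕ m) _ ⟩
    _ ≈⟨ +-cong (sum-δ (st x) x<N (u ^_)) (∑-fibres st u N xs ps) ⟩
    u ^ st x + ∑ₗ xs (λ x → u ^ st x) ∎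
    where
    length-filter-∷ : ∀ m → length (filter (λ y → st y ℕₚ.≟ m) (x ∷ xs)) ≡
                            δ (st x) m +ₙ length (filter (λ y → st y ℕₚ.≟ m) xs)
    length-filter-∷ m with st x ℕₚ.≟ m
    ... | yes ≡.refl = ≡.trans (≡.cong length (filter-accept (λ y → st y ℕₚ.≟ m) {x} {xs} ≡.refl))
                               (≡.cong₂ _+ₙ_ (≡.sym (δ-refl (st x))) ≡.refl)
    ... | no  x≢m    = ≡.trans (≡.cong length (filter-reject (λ y → st y ℕₚ.≟ m) {x} {xs} x≢m))
                               (≡.cong₂ _+ₙ_ (≡.sym (δ-≢ (st x) m x≢m)) ≡.refl)

-- The two double sums, compared by the parity of the exponent.

⌊double/2⌋ : ∀ k → ⌊ double k /2⌋ ≡ k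
⌊double/2⌋ zero    = ≡.refl
⌊double/2⌋ (suc k) = ≡.cong suc (⌊double/2⌋ k)

⌈double/2⌉ : ∀ k → ⌈ double k /2⌉ ≡ k
⌈double/2⌉ zero    = ≡.refl
⌈double/2⌉ (suc k) = ≡.cong suc (⌈double/2⌉ k)

n≤double : ∀ n → n ≤ double n
n≤double zero    = z≤n
n≤double (suc n) = s≤s (ℕₚ.m≤n⇒m≤1+n (n≤double n))

data Parity : ℕ → Set where
  even : ∀ k → Parity (double k)
  odd  : ∀ k → Parity (suc (double k))

parity : ∀ n → Parity n
parity zero    = even zero
parity (suc n) with parity n
... | even k = odd k
... | odd  k = even (suc k)

module Theorem {c ℓ} (R : CommutativeRing c ℓ) (t : CommutativeRing.Carrier R) where
  open CommutativeRing R hiding (zero)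
  open import Relation.Binary.Reasoning.Setoid setoid
  open import Algebra.Properties.Semiring.Mult semiring using (×-congʳ) renaming (_×_ to _·_)
  open import Algebra.Properties.Semiring.Exp semiring using (_^_; ^-congˡ)
  open import Algebra.Properties.Semiring.Sum semiring using (sum; sum-cong-≋; sum-replicate-zero)
  open PowerSeries R using (_✶_; ✶-identityˡ; var-✶-suc; var-✶-0)
  open Functionals R t
  open Block R t
  open Expansion R t
  open RawSemiringDefs (RawRing.rawSemiring (powerSeries rawRing)) using () renaming (_^_ to _^ᴾ_)

  evenTerms oddTerms : ℕ → ℕ → ℤ → Carrier
  evenTerms = evenTermOf rawRing t
  oddTerms = oddTermOf rawRing t

  coeff-fromSeries : ∀ f n → coeff rawRing (fromSeries rawRing f) (ℤ.+ n) ≡ f n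
  coeff-fromSeries f n = ≡.cong f (ℕₚ.+-identityʳ n)

  coeff-var⁻¹ : ∀ f n → coeff rawRing (_*ᴸ_ rawRing (var⁻¹ rawRing) (fromSeries rawRing f)) (ℤ.+ n) ≈ f (suc n)
  coeff-var⁻¹ f n = trans (reflexive (≡.cong (const rawRing 1# ✶ f) (ℕₚ.+-comm n 1))) (✶-identityˡ f (suc n))

  ·-zero : ∀ n {x} → x ≈ 0# → n · x ≈ 0#
  ·-zero zero    x≈0 = refl
  ·-zero (suc n) x≈0 = trans (+-cong x≈0 (·-zero n x≈0)) (+-identityˡ 0#)

  evenTerms-+ : ∀ p q n → evenTerms p q (ℤ.+ n) ≈ ((p +ₙ q) !) · ([ n ]B^ p * [ n ]B^ q)
  evenTerms-+ p q n = ×-congʳ ((p +ₙ q) !)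
    (*-cong (reflexive (coeff-fromSeries (B ^ᴾ p) n)) (reflexive (coeff-fromSeries (B ^ᴾ q) n)))

  oddTerms-+ : ∀ p q n → oddTerms p q (ℤ.+ n) ≈ ((p +ₙ q) !) · ([ suc n ]B^ p * (var rawRing ✶ B ^ᴾ q) n)
  oddTerms-+ p q n = ×-congʳ ((p +ₙ q) !)
    (*-cong (coeff-var⁻¹ (B ^ᴾ p) n) (reflexive (coeff-fromSeries (var rawRing ✶ B ^ᴾ q) n)))

  square : (ℕ → ℕ → Carrier) → ℕ → Carrier
  square G N = sum {N} λ p → sum {N} λ q → G (toℕ p) (toℕ q)

  -- The cutoff n + 2 is dictated by the odd terms: the factor z⁻¹ brings in the coefficient of
  -- z^(n+1) in B^p, which vanishes for p > n + 1.
  square-sum : (ℕ → ℕ → ℤ → Carrier) → ℕ → Carrier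
  square-sum F n = square (λ p q → F p q (ℤ.+ n)) (suc (suc n))

  hasDoubleSum : ∀ F → (∀ p q n → F p q -[1+ n ] ≈ 0#) →
    (∀ p q n → suc (suc n) ≤ p ⊎ suc (suc n) ≤ q → F p q (ℤ.+ n) ≈ 0#) →
    HasDoubleSum rawRing F (square-sum F)
  hasDoubleSum F neg van -[1+ n ] = 0 , (λ p q _ → neg p q n) , refl
  hasDoubleSum F neg van (ℤ.+ n) = suc (suc n) , (λ p q → van p q n) ,
    reflexive (≡.sym (coeff-fromSeries (square-sum F) n))

  square-cong : ∀ {F G : ℕ → ℕ → Carrier} N → (∀ p q → F p q ≈ G p q) → square F N ≈ square G N
  square-cong N F≈G = sum-cong-≋ {N} λ p → sum-cong-≋ {N} λ q → F≈G (toℕ p) (toℕ q)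

  square-zero : ∀ N → square (λ _ _ → 0#) N ≈ 0#
  square-zero N = trans (sum-cong-≋ {N} λ _ → sum-replicate-zero N) (sum-replicate-zero N)

  zero-*-zero : ∀ {x y} → x ≈ 0# ⊎ y ≈ 0# → x * y ≈ 0#
  zero-*-zero (inj₁ x≈0) = trans (*-congʳ x≈0) (zeroˡ _)
  zero-*-zero (inj₂ y≈0) = trans (*-congˡ y≈0) (zeroʳ _)

  evenTerms-hasDoubleSum : HasDoubleSum rawRing evenTerms (square-sum evenTerms)
  evenTerms-hasDoubleSum = hasDoubleSum evenTerms
    (λ p q n → ·-zero ((p +ₙ q) !) (zeroˡ 0#))
    λ p q n N≤ → trans (evenTerms-+ p q n) (·-zero ((p +ₙ q) !) (zero-*-zero (vanish N≤)))
    where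
    vanish : ∀ {p q n} → suc (suc n) ≤ p ⊎ suc (suc n) ≤ q → [ n ]B^ p ≈ 0# ⊎ [ n ]B^ q ≈ 0#
    vanish (inj₁ N≤p) = inj₁ (B^-vanish (ℕₚ.<⇒≤ N≤p))
    vanish (inj₂ N≤q) = inj₂ (B^-vanish (ℕₚ.<⇒≤ N≤q))

  oddTerms-hasDoubleSum : HasDoubleSum rawRing oddTerms (square-sum oddTerms)
  oddTerms-hasDoubleSum = hasDoubleSum oddTerms
    -- The left factor may have a term in z⁻¹, but the right one is a power series and has no
    -- negative exponents.
    (λ p q n → ·-zero ((p +ₙ q) !) (zeroʳ _))
    λ p q n N≤ → trans (oddTerms-+ p q n) (·-zero ((p +ₙ q) !) (zero-*-zero (vanish n N≤)))
    where
    vanish : ∀ {p q} n → suc (suc n) ≤ p ⊎ suc (suc n) ≤ q →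
             [ suc n ]B^ p ≈ 0# ⊎ (var rawRing ✶ B ^ᴾ q) n ≈ 0#
    vanish n (inj₁ N≤p) = inj₁ (B^-vanish N≤p)
    vanish {q = q} zero (inj₂ N≤q) = inj₂ (var-✶-0 (B ^ᴾ q))
    vanish {q = q} (suc n) (inj₂ N≤q) = inj₂ (trans (var-✶-suc (B ^ᴾ q) n)
      (B^-vanish (ℕₚ.<⇒≤ (ℕₚ.<⇒≤ N≤q))))

  T² : ℕ → ℕ → Carrier
  T² k k′ = T k (λ p → T k′ (λ q → ((p +ₙ q) !) · 1#))

  B^*B^ : ℕ → ℕ → ℕ → ℕ → Carrier
  B^*B^ k k′ p q = ((p +ₙ q) !) · ([ double k ]B^ p * [ double k′ ]B^ q)

  evenTerms-even : ∀ k → square-sum evenTerms (double k) ≈ T² k k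
  evenTerms-even k = trans
    (square-cong {λ p q → evenTerms p q (ℤ.+ double k)} {B^*B^ k k} (suc (suc (double k))) λ p q → evenTerms-+ p q (double k))
    (∑∑-B^ k k k<N k<N)
    where
    k<N : k < suc (suc (double k))
    k<N = s≤s (ℕₚ.m≤n⇒m≤1+n (n≤double k))

  evenTerms-odd : ∀ k → square-sum evenTerms (suc (double k)) ≈ 0#
  evenTerms-odd k = trans
    (square-cong {λ p q → evenTerms p q (ℤ.+ suc (double k))} {λ _ _ → 0#} N λ p q → trans (evenTerms-+ p q (suc (double k)))
      (·-zero ((p +ₙ q) !) (zero-*-zero (inj₁ (B^-odd p k)))))
    (square-zero N)
    where
    N = suc (suc (suc (double k)))

  oddTerms-even : ∀ k → square-sum oddTerms (double k) ≈ 0#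
  oddTerms-even k = trans
    (square-cong {λ p q → oddTerms p q (ℤ.+ double k)} {λ _ _ → 0#} N λ p q → trans (oddTerms-+ p q (double k))
      (·-zero ((p +ₙ q) !) (zero-*-zero (inj₁ (B^-odd p k)))))
    (square-zero N)
    where
    N = suc (suc (double k))

  -- The factors z⁻¹ and z move the exponent 2k + 1 to 2k + 2 and 2k, matching the k + 1 positions
  -- of one path and the k of the other.
  oddTerms-odd : ∀ k → square-sum oddTerms (suc (double k)) ≈ T² (suc k) k
  oddTerms-odd k = trans
    (square-cong {λ p q → oddTerms p q (ℤ.+ suc (double k))} {B^*B^ (suc k) k} (suc (suc (suc (double k)))) λ p q →
      trans (oddTerms-+ p q (suc (double k)))
        (×-congʳ ((p +ₙ q) !) (*-congˡ (var-✶-suc (B ^ᴾ q) (double k)))))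
    (∑∑-B^ (suc k) k 1+k<N (ℕₚ.<-trans (ℕₚ.n<1+n k) 1+k<N))
    where
    1+k<N : suc k < suc (suc (suc (double k)))
    1+k<N = s≤s (s≤s (ℕₚ.m≤n⇒m≤1+n (n≤double k)))

  square-sums : ∀ {n} → Parity n → square-sum evenTerms n + square-sum oddTerms n ≈ T² ⌈ n /2⌉ ⌊ n /2⌋
  square-sums (even k) = begin
    square-sum evenTerms (double k) + square-sum oddTerms (double k)
      ≈⟨ +-cong (evenTerms-even k) (oddTerms-even k) ⟩
    T² k k + 0# ≈⟨ +-identityʳ _ ⟩
    T² k k ≡⟨ ≡.cong₂ T² (⌈double/2⌉ k) (⌊double/2⌋ k) ⟨
    T² ⌈ double k /2⌉ ⌊ double k /2⌋ ∎
  square-sums (odd k) = begin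
    square-sum evenTerms (suc (double k)) + square-sum oddTerms (suc (double k))
      ≈⟨ +-cong (evenTerms-odd k) (oddTerms-odd k) ⟩
    0# + T² (suc k) k ≈⟨ +-identityˡ _ ⟩
    T² (suc k) k ≡⟨ ≡.cong₂ T² (≡.cong suc (⌊double/2⌋ k)) (⌈double/2⌉ k) ⟨
    T² ⌈ suc (double k) /2⌉ ⌊ suc (double k) /2⌋ ∎

  generatingFunction : ∀ u → u ≈ 1# + t → ∀ n →
    sum {suc n} (λ m → s n (toℕ m) · u ^ toℕ m) ≈ square-sum evenTerms n + square-sum oddTerms n
  generatingFunction u u≈1+t n = begin
    sum {suc n} (λ m → s n (toℕ m) · u ^ toℕ m)
      ≈⟨ ∑-fibres separators u (suc n) (S n) (All.universal separators<1+n (S n)) ⟩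
    ∑ₗ (S n) (λ π → u ^ separators π)
      ≈⟨ ∑ₗ-cong′ (S n) (λ π → trans (reflexive (≡.cong (u ^_) (separators≡leads π))) (^-congˡ (leads π) u≈1+t)) ⟩
    ∑ₗ (S n) (λ π → (1# + t) ^ leads π)
      ≈⟨ ∑-1+t^leads n ⟩
    T² ⌈ n /2⌉ ⌊ n /2⌋
      ≈⟨ square-sums (parity n) ⟨
    square-sum evenTerms n + square-sum oddTerms n ∎
    where
    separators<1+n : (π : Vec (Fin n) n) → separators π < suc n
    separators<1+n π = s≤s (ℕₚ.≤-trans (length-filter (isVerticalSeparator? π) (allFin n))
      (ℕₚ.≤-reflexive (length-tabulate id)))

-- Specialisation to coefficients in ℚ⟦u⟧.

module _ {c ℓ} (R : CommutativeRing c ℓ) where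
  open CommutativeRing R
  open import Relation.Binary.Reasoning.Setoid setoid

  x≈1+[x-1] : ∀ x → x ≈ 1# + (x - 1#)
  x≈1+[x-1] x = begin
    x               ≈⟨ +-identityʳ x ⟨
    x + 0#          ≈⟨ +-congˡ (-‿inverseˡ 1#) ⟨
    x + (- 1# + 1#) ≈⟨ +-assoc x (- 1#) 1# ⟨
    x - 1# + 1#     ≈⟨ +-comm (x - 1#) 1# ⟩
    1# + (x - 1#)   ∎

-- Only raw operations occur, with t written as x - 1, so the statement can be transported along an
-- equality of raw rings.
SeparatorFormula : ∀ {c ℓ} → RawRing c ℓ → Set _
SeparatorFormula X = ∀ x → ∃₂ λ f g →
  HasDoubleSum X (evenTermOf X (x + - 1#)) f ×
  HasDoubleSum X (oddTermOf X (x + - 1#)) g ×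
  ∀ n → sum {suc n} (λ m → s n (toℕ m) · x ^ toℕ m) ≈ f n + g n
  where
  open RawRing X
  open RawSemiringDefs rawSemiring using (sum; _^_) renaming (_×_ to _·_)

separatorFormula : ∀ {c ℓ} (R : CommutativeRing c ℓ) → SeparatorFormula (CommutativeRing.rawRing R)
separatorFormula R x = square-sum evenTerms , square-sum oddTerms ,
  evenTerms-hasDoubleSum , oddTerms-hasDoubleSum , generatingFunction x (x≈1+[x-1] R x)
  where open Theorem R (CommutativeRing._-_ R x (CommutativeRing.1# R))

theorem3p11 : ∃₂ λ f g →
    HasDoubleSum ℚ⟦u⟧ evenTerm f ×
    HasDoubleSum ℚ⟦u⟧ oddTerm g ×
    h ≋ (f ⊕ g)
theorem3p11 = ≡.subst SeparatorFormula rawRing-ℚ⟦u⟧ (separatorFormula ℚ⟦u⟧-ring) (var ℚ.+-*-rawRing)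
  where
  ℚ⟦u⟧-ring = PowerSeries.commutativeRing ℚₚ.+-*-commutativeRing
  rawRing-ℚ⟦u⟧ : CommutativeRing.rawRing ℚ⟦u⟧-ring ≡ ℚ⟦u⟧
  rawRing-ℚ⟦u⟧ = ≡.refl
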